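{- There is an absolute constant $C>0$ such that for every finite Abelian group $G$: (i) there is a deterministic query algorithm which, for every finite set $X$ and every $f:G\to X$ hiding a subgroup $H\le G$, correctly decides whether $H$ is trivial using at most $C\sqrt{|G|/|H|}$ queries; (ii) there is a deterministic query algorithm which, for every finite set $X$ and every $f:G\to X$ hiding a subgroup $H\le G$, outputs $H$ using at most $C\left(\sqrt{\frac{|G|}{|H|}\max\{1,\log_2|H|\}}+\log_2|H|\right)$ queries. (The algorithms have no prior information about $H$.)
   Context: Hidden subgroup problem ($\mathsf{HSP}$): $G$ is a finite group (known to the algorithm, here given as a direct product of cyclic groups of prime-power order), $X$ a finite set, and $f:G\to X$ is an unknown function with the promise that there is a subgroup $H\le G$ such that for all $g_1,g_2\in G$, $f(g_1)=f(g_2)$ iff $g_1H=g_2H$; we say $f$ hides $H$. The identification version asks to output $H$; the decision version asks whether $H$ is trivial. A deterministic query algorithm accesses $f$ only by adaptively choosing elements $g\in G$ and receiving $f(g)$ (a query); its query complexity on $f$ is the number of queries made. -}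

module Defs where

open import Algebra.Bundles using (AbelianGroup)
open import Data.Fin.Base using (Fin; toℕ)
open import Data.Fin.Subset using (Subset; _∈_; ∣_∣)
open import Data.Fin.Subset.Properties using (x∈p⇒∣p-x∣<∣p∣)
open import Data.Integer.Base as ℤ using (+_)
open import Data.Nat.Base as ℕ using (ℕ; zero; suc; NonZero)
import Data.Nat.Coprimality as Coprimality
import Data.Nat.Properties as ℕ
open import Data.Product.Base using (∃; ∃₂; _×_; _,_)
open import Data.Rational.Base
  using (ℚ; mkℚ; 0ℚ; 1ℚ; _/_; _+_; _*_; _⊔_; _≤_; nonNegative; ↥_; ↧ₙ_)
import Data.Rational.Properties as ℚ
open import Function.Bundles using (Inverse; _↔_; _⇔_)
open import Level using (0ℓ)
open import Relation.Binary.PropositionalEquality as ≡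
  using (_≡_; refl; subst)

-- A non-negative real is presented by an inhabited set of non-negative
-- rationals of which it is the infimum.  This suffices to state upper
-- bounds, and each operation below presents the exact real value.

record ℝ₀⁺ : Set₁ where
  field
    Bound     : ℚ → Set
    inhabited : ∃ Bound
    bound≥0   : ∀ {r} → Bound r → 0ℚ ≤ r

open ℝ₀⁺

infix  4 _≤ʳ_
infixl 6 _+ʳ_ _⊔ʳ_
infixl 7 _*ʳ_ _÷_

-- k ≤ inf S exactly when k is a lower bound of S.

_≤ʳ_ : ℕ → ℝ₀⁺ → Set
k ≤ʳ x = ∀ {r} → Bound x r → + k / 1 ≤ r

_÷_ : (a b : ℕ) .{{_ : NonZero b}} → ℝ₀⁺
(a ÷ b) .Bound r = r ≡ + a / b
(a ÷ b) .inhabited = + a / b , refl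
(a ÷ b) .bound≥0 refl = ℚ.nonNegative⁻¹ _ {{ℚ.normalize-nonNeg a b}}

fromℕ : ℕ → ℝ₀⁺
fromℕ a = a ÷ 1

_+ʳ_ : ℝ₀⁺ → ℝ₀⁺ → ℝ₀⁺
(x +ʳ y) .Bound r = ∃₂ λ s t → Bound x s × Bound y t × r ≡ s + t
(x +ʳ y) .inhabited with inhabited x | inhabited y
... | s , s∈x | t , t∈y = s + t , s , t , s∈x , t∈y , refl
(x +ʳ y) .bound≥0 (s , t , s∈x , t∈y , refl) =
  ℚ.+-mono-≤ (bound≥0 x s∈x) (bound≥0 y t∈y)

_*ʳ_ : ℝ₀⁺ → ℝ₀⁺ → ℝ₀⁺
(x *ʳ y) .Bound r = ∃₂ λ s t → Bound x s × Bound y t × r ≡ s * t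
(x *ʳ y) .inhabited with inhabited x | inhabited y
... | s , s∈x | t , t∈y = s * t , s , t , s∈x , t∈y , refl
(x *ʳ y) .bound≥0 (s , t , s∈x , t∈y , refl) =
  ℚ.nonNegative⁻¹ (s * t) {{ℚ.nonNeg*nonNeg⇒nonNeg s t}}
  where instance
    _ = nonNegative (bound≥0 x s∈x)
    _ = nonNegative (bound≥0 y t∈y)

_⊔ʳ_ : ℝ₀⁺ → ℝ₀⁺ → ℝ₀⁺
(x ⊔ʳ y) .Bound r = ∃₂ λ s t → Bound x s × Bound y t × r ≡ s ⊔ t
(x ⊔ʳ y) .inhabited with inhabited x | inhabited y
... | s , s∈x | t , t∈y = s ⊔ t , s , t , s∈x , t∈y , refl
(x ⊔ʳ y) .bound≥0 (s , t , s∈x , t∈y , refl) =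
  ℚ.≤-trans (bound≥0 x s∈x) (ℚ.p≤p⊔q s t)

s≤[s+1]² : ∀ {s} → 0ℚ ≤ s → s ≤ (s + 1ℚ) * (s + 1ℚ)
s≤[s+1]² {s} 0≤s = begin
  s                       ≡⟨ ℚ.*-identityʳ s ⟨
  s * 1ℚ                  ≤⟨ ℚ.*-monoˡ-≤-nonNeg s 1≤s+1 ⟩
  s * (s + 1ℚ)            ≤⟨ ℚ.*-monoʳ-≤-nonNeg (s + 1ℚ) s≤s+1 ⟩
  (s + 1ℚ) * (s + 1ℚ)     ∎
  where
  open ℚ.≤-Reasoning
  0≤1 : 0ℚ ≤ 1ℚ
  0≤1 = ℚ.nonNegative⁻¹ 1ℚ
  s≤s+1 : s ≤ s + 1ℚ
  s≤s+1 = subst (_≤ s + 1ℚ) (ℚ.+-identityʳ s) (ℚ.+-monoʳ-≤ s 0≤1)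
  1≤s+1 : 1ℚ ≤ s + 1ℚ
  1≤s+1 = subst (_≤ s + 1ℚ) (ℚ.+-identityˡ 1ℚ) (ℚ.+-monoˡ-≤ 1ℚ 0≤s)
  instance
    _ = nonNegative 0≤s
    _ = nonNegative (ℚ.≤-trans 0≤s s≤s+1)

√_ : ℝ₀⁺ → ℝ₀⁺
(√ x) .Bound r = 0ℚ ≤ r × ∃ λ s → Bound x s × s ≤ r * r
(√ x) .inhabited with inhabited x
... | s , s∈x = s + 1ℚ
              , ℚ.+-mono-≤ (bound≥0 x s∈x) (ℚ.nonNegative⁻¹ 1ℚ)
              , s , s∈x , s≤[s+1]² (bound≥0 x s∈x)
(√ x) .bound≥0 (0≤r , _) = 0≤r

n≤2^n : ∀ n → n ℕ.≤ 2 ℕ.^ n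
n≤2^n zero    = ℕ.z≤n
n≤2^n (suc n) = begin
  1 ℕ.+ n                         ≤⟨ ℕ.+-mono-≤ (ℕ.m^n>0 2 n) (n≤2^n n) ⟩
  2 ℕ.^ n ℕ.+ 2 ℕ.^ n             ≤⟨ ℕ.+-monoʳ-≤ (2 ℕ.^ n) (ℕ.m≤m+n (2 ℕ.^ n) 0) ⟩
  2 ℕ.* 2 ℕ.^ n                   ∎
  where open ℕ.≤-Reasoning

-- For r = a / b ≥ 0, the inequality log₂ n ≤ r says n ^ b ≤ 2 ^ a.

log₂ : (n : ℕ) .{{_ : NonZero n}} → ℝ₀⁺
log₂ n .Bound r = 0ℚ ≤ r × n ℕ.^ ↧ₙ r ℕ.≤ 2 ℕ.^ ℤ.∣ ↥ r ∣
log₂ n .inhabited =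
    mkℚ (+ n) 0 (Coprimality.sym (Coprimality.1-coprimeTo n))
  , ℚ.nonNegative⁻¹ _
  , subst (ℕ._≤ 2 ℕ.^ n) (≡.sym (ℕ.*-identityʳ n)) (n≤2^n n)
log₂ n .bound≥0 (0≤r , _) = 0≤r

record FiniteSet : Set₁ where
  field
    Carrier     : Set
    size        : ℕ
    enumeration : Carrier ↔ Fin size

  label : Carrier → ℕ
  label x = toℕ (Inverse.to enumeration x)

record FiniteAbelianGroup : Set₁ where
  field
    abelianGroup : AbelianGroup 0ℓ 0ℓ

  open AbelianGroup abelianGroup public

  field
    order       : ℕ
    enumeration : Inverse setoid (≡.setoid (Fin order))

  index : Carrier → Fin order
  index = Inverse.to enumeration

  -- Subsets of the group are subsets of the set of indices, so that ∣ H ∣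
  -- counts elements up to _≈_.

  infix 4 _∈ᴳ_
  _∈ᴳ_ : Carrier → Subset order → Set
  g ∈ᴳ H = index g ∈ H

  record IsSubgroup (H : Subset order) : Set where
    field
      ε-closed  : ε ∈ᴳ H
      ∙-closed  : ∀ {g h} → g ∈ᴳ H → h ∈ᴳ H → (g ∙ h) ∈ᴳ H
      ⁻¹-closed : ∀ {g} → g ∈ᴳ H → (g ⁻¹) ∈ᴳ H

  record Subgroup : Set where
    field
      subset     : Subset order
      isSubgroup : IsSubgroup subset

    open IsSubgroup isSubgroup public

    card : ℕ
    card = ∣ subset ∣

    instance
      card-nonZero : NonZero card
      card-nonZero = ℕ.>-nonZero (ℕ.≤-<-trans ℕ.z≤n (x∈p⇒∣p-x∣<∣p∣ ε-closed))

    IsTrivial : Set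
    IsTrivial = ∀ g → g ∈ᴳ subset → g ≈ ε

    infix 4 _∈-coset_
    _∈-coset_ : Carrier → Carrier → Set
    x ∈-coset g = ∃ λ h → h ∈ᴳ subset × x ≈ g ∙ h

    SameCoset : Carrier → Carrier → Set
    SameCoset g₁ g₂ = ∀ x → x ∈-coset g₁ ⇔ x ∈-coset g₂

    HiddenBy : {X : Set} → (Carrier → X) → Set
    HiddenBy f = ∀ g₁ g₂ → f g₁ ≡ f g₂ ⇔ SameCoset g₁ g₂

-- An adaptive algorithm with outputs in R querying an unknown function on
-- Q.  Answers are natural-number labels, so that one and the same
-- algorithm is run against functions into arbitrary finite sets.

data QueryAlgorithm (Q R : Set) : Set where
  output : R → QueryAlgorithm Q R
  query  : Q → (ℕ → QueryAlgorithm Q R) → QueryAlgorithm Q R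

module _ {Q R : Set} (X : FiniteSet) (f : Q → FiniteSet.Carrier X) where

  result : QueryAlgorithm Q R → R
  result (output r)  = r
  result (query q k) = result (k (FiniteSet.label X (f q)))

  queries : QueryAlgorithm Q R → ℕ
  queries (output r)  = 0
  queries (query q k) = suc (queries (k (FiniteSet.label X (f q))))

{-# OPTIONS --safe #-}
module Submission where

-- Climb a chain of subgroups {ε} = K₀ < K₁ < … < G in which Kᵢ₊₁ is generated
-- by Kᵢ and some g with p · g ∈ Kᵢ for a prime p, keeping track of H ∩ Kᵢ.  By
-- primality, H ∩ Kᵢ₊₁ is larger than H ∩ Kᵢ iff H meets the single coset g ∙ Kᵢ.
-- Given a transversal D of H ∩ Kᵢ in Kᵢ, this is the case iff f (g ∙ s ⁻¹) = f t
-- for some s ∈ S and t ∈ T, where D ⊆ S ∙ T.  Here T can be any prefix of D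
-- (ordered by the mixed-radix digits of its elements), with ∣S∣ ≤ 4 ∣D∣ / ∣T∣.
--
-- If H does not meet g ∙ Kᵢ then D grows by the factor p, otherwise D remains a
-- transversal; always ∣D∣ ∣H∣ ≤ ∣G∣, and after k discoveries 2 ^ k ≤ ∣H∣.  The
-- answers on T are reused, so with ∣T∣ ≈ √(∣D∣ (k + 1)) each test costs only
-- O(√(∣D∣ / (k + 1)) + 1) further queries.  These sum to O(√(∣D∣ (k + 1)) + k):
-- geometrically in ∣D∣ over the failed tests, like Σ 1 / √k over the others.
-- Stopping at the first discovery decides whether H is trivial.

open import Defs
open import Algebra.Bundles using (AbelianGroup; CommutativeMonoid)
import Algebra.Properties.AbelianGroup as AbelianGroupProperties
import Algebra.Properties.CommutativeMonoid.Mult as Mult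
import Algebra.Properties.CommutativeSemigroup as CommutativeSemigroupProperties
open import Data.Bool.Base using (Bool; true; false)
open import Data.Fin.Base using (Fin; zero; suc; toℕ)
import Data.Fin.Properties as Fin
open import Data.Fin.Subset using (Subset; _∈_; _⊃_; _-_; ⁅_⁆; ∣_∣; outside; inside) renaming (⊤ to full)
open import Data.Fin.Subset.Induction using (⊃-wellFounded)
open import Data.Fin.Subset.Properties
  using (_∈?_; x∈p∧x≢y⇒x∈p-y; x∈p⇒∣p-x∣<∣p∣; ∣⊤∣≡n; ∈⊤; x∈⁅x⁆; x∈⁅y⁆⇒x≡y; ⊆-antisym)
open import Data.Integer.Base as ℤ using (+_)
import Data.Integer.Properties as ℤ
open import Data.List.Base using (List; []; _∷_; [_]; map; _++_; length; take; drop; cartesianProductWith)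
import Data.List.Membership.Setoid as SetoidMembership
open import Data.List.Membership.Setoid.Properties using (∈-++⁺ˡ; ∈-++⁺ʳ; ∈-++⁻; ∈-map⁺; ∈-map⁻)
  renaming (∈-resp-≈ to ∈ˡ-resp-≈)
open import Data.List.Properties
  using (length-map; length-++; map-++; ++-assoc; length-take; length-drop; take-take; take++drop≡id)
open import Data.List.Relation.Unary.All as All using (All; []; _∷_)
import Data.List.Relation.Unary.All.Properties as All
open import Data.List.Relation.Unary.AllPairs as AllPairs using (AllPairs; []; _∷_)
import Data.List.Relation.Unary.AllPairs.Properties as AllPairs
open import Data.List.Relation.Unary.Any as Any using (Any; here; there)
import Data.List.Relation.Unary.Any.Properties as Any
open import Data.Nat.Base as ℕ
  using (ℕ; zero; suc; _≤_; _<_; z≤n; s≤s; s<s; z<s; _∸_; NonZero; _%_; _/_; _⊓_; _⊔_; _^_)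
open import Data.Nat.Coprimality as Coprimality using (coprime-Bézout; prime⇒coprime)
import Data.Nat.DivMod as ℕ
open import Data.Nat.GCD using (module Bézout)
open import Data.Nat.ListAction using (product)
open import Data.Nat.Primality using (Prime; prime⇒nonZero; prime⇒nonTrivial)
open import Data.Nat.Primality.Factorisation using (factorise)
import Data.Nat.Properties as ℕ
open import Data.Nat.Solver using (module +-*-Solver)
open import Data.Product.Base using (Σ-syntax; ∃-syntax; ∃; ∃₂; _×_; _,_; proj₁; proj₂)
open import Data.Rational.Base as ℚ using (ℚ; 0ℚ; toℚᵘ; ↥_; ↧_; ↧ₙ_)
import Data.Rational.Properties as ℚ
open import Data.Rational.Unnormalised.Base as ℚᵘ using (mkℚᵘ)
import Data.Rational.Unnormalised.Properties as ℚᵘ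
open import Data.Sum.Base using (_⊎_; inj₁; inj₂)
open import Data.Vec.Base using ([]; _∷_; here; there; tabulate)
open import Data.Vec.Properties using (lookup⇒[]=; []=⇒lookup; lookup∘tabulate)
open import Function.Base using (_∘_; case_of_)
open import Function.Bundles using (Inverse; Equivalence; _⇔_; mk⇔)
open import Induction.WellFounded using (Acc; acc)
open import Level using (0ℓ)
import Relation.Binary.PropositionalEquality as ≡
open import Relation.Binary.PropositionalEquality using (_≡_; _≢_)
import Relation.Binary.Reasoning.Setoid as SetoidReasoning
open import Relation.Nullary using (Dec; yes; no; does; ¬_; contradiction)
open import Relation.Nullary.Decidable using (dec-true; ¬?; decidable-stable)
open import Relation.Unary using (Decidable)

-- Neither the size of H nor the number of hits to come is known, so no balance between S and T can
-- be fixed in advance. A prefix of length y is paid for once, while each of roughly k + 1 tests on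
-- m elements costs about m / y; the two totals meet at y² = m (k + 1). As m and k never decrease,
-- neither does this target, and no answer is ever discarded. The target ignores digit boundaries,
-- however, so a cofactor must exist for every length of the prefix; rounding to whole digits costs
-- the factor 4.
--
-- D is in general no subgroup, but covering it by S ∙ T is enough. If h lies in H and in g ∙ Kᵢ,
-- then g ∙ h ⁻¹ lies in Kᵢ and agrees modulo H with some s ∙ t, so f (g ∙ s ⁻¹) = f t. Conversely,
-- such an equality puts g ∙ s ⁻¹ ∙ t ⁻¹ into H, and into g ∙ Kᵢ because S and T lie in Kᵢ.
--
-- After a hit, h can take the place of g as the new generator. Being in H, it creates no new coset
-- of H, which is why D survives unchanged.

-- Lists, finite subsets and a rounding estimate.

take-++ : ∀ {A : Set} n (xs ys : List A) → n ≤ length xs → take n (xs ++ ys) ≡ take n xs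
take-++ zero    xs       ys _         = ≡.refl
take-++ (suc n) (x ∷ xs) ys (s≤s n≤∣xs∣) = ≡.cong (x ∷_) (take-++ n xs ys n≤∣xs∣)

-- Two roundings cost a factor 2 each: `b = x / m` is at least 1, so `x ≤ 2 * b * m`, and `b ≤ p`,
-- so `suc (p / b) * b ≤ 2 * p`. The left side is what the cofactor in `splitting-long` amounts to.
suc[p/b]*x≤4pm : ∀ p m x .{{_ : NonZero m}} .{{_ : NonZero (x / m)}} → x ≤ p ℕ.* m →
                 suc (p / (x / m)) ℕ.* x ≤ 4 ℕ.* (p ℕ.* m)
suc[p/b]*x≤4pm p m x x≤p*m = begin
  s ℕ.* x                        ≤⟨ ℕ.*-monoʳ-≤ s x≤2bm ⟩
  s ℕ.* (b ℕ.* m ℕ.+ b ℕ.* m)    ≡⟨ solve 3 (λ s b m → s :* (b :* m :+ b :* m) := (con 2 :* m) :* (s :* b)) ≡.refl s b m ⟩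
  2 ℕ.* m ℕ.* (s ℕ.* b)          ≤⟨ ℕ.*-monoʳ-≤ (2 ℕ.* m) (ℕ.+-mono-≤ b≤p (ℕ.m/n*n≤m p b)) ⟩
  2 ℕ.* m ℕ.* (p ℕ.+ p)          ≡⟨ solve 2 (λ p m → con 2 :* m :* (p :+ p) := con 4 :* (p :* m)) ≡.refl p m ⟩
  4 ℕ.* (p ℕ.* m)                ∎
  where
  open ℕ.≤-Reasoning
  open +-*-Solver
  b = x / m
  s = suc (p / b)
  b≤p : b ≤ p
  b≤p = ℕ.*-cancelʳ-≤ b p m (ℕ.≤-trans (ℕ.m/n*n≤m x m) x≤p*m)
  x≤2bm : x ≤ b ℕ.* m ℕ.+ b ℕ.* m
  x≤2bm = begin
    x                       ≡⟨ ℕ.m≡m%n+[m/n]*n x m ⟩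
    x % m ℕ.+ b ℕ.* m       ≤⟨ ℕ.+-monoˡ-≤ (b ℕ.* m) (ℕ.≤-trans (ℕ.<⇒≤ (ℕ.m%n<n x m)) (ℕ.m≤n*m m b)) ⟩
    b ℕ.* m ℕ.+ b ℕ.* m     ∎

length-cartesianProductWith : ∀ {A B C : Set} (f : A → B → C) xs ys →
                              length (cartesianProductWith f xs ys) ≡ length xs ℕ.* length ys
length-cartesianProductWith f []       ys = ≡.refl
length-cartesianProductWith f (x ∷ xs) ys = ≡.trans (length-++ (map (f x) ys))
  (≡.cong₂ ℕ._+_ (length-map (f x) ys) (length-cartesianProductWith f xs ys))

members : ∀ {n} → Subset n → List (Fin n)
members []            = []
members (outside ∷ p) = map suc (members p)
members (inside  ∷ p) = zero ∷ map suc (members p)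

length-members : ∀ {n} (p : Subset n) → length (members p) ≡ ∣ p ∣
length-members []            = ≡.refl
length-members (outside ∷ p) = ≡.trans (length-map suc (members p)) (length-members p)
length-members (inside  ∷ p) = ≡.cong suc (≡.trans (length-map suc (members p)) (length-members p))

members⊆ : ∀ {n} (p : Subset n) → All (_∈ p) (members p)
members⊆ []            = []
members⊆ (outside ∷ p) = All.map⁺ (All.map there (members⊆ p))
members⊆ (inside  ∷ p) = here ∷ All.map⁺ (All.map there (members⊆ p))

members-unique : ∀ {n} (p : Subset n) → AllPairs _≢_ (members p)
members-unique []            = []
members-unique (outside ∷ p) = AllPairs.map⁺ (AllPairs.map (_∘ Fin.suc-injective) (members-unique p))
members-unique (inside  ∷ p) = All.map⁺ (All.universal (λ _ ()) (members p))
  ∷ AllPairs.map⁺ (AllPairs.map (_∘ Fin.suc-injective) (members-unique p))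

unique-⊆⇒length≤ : ∀ {n} {xs : List (Fin n)} (p : Subset n) → AllPairs _≢_ xs → All (_∈ p) xs → length xs ≤ ∣ p ∣
unique-⊆⇒length≤ p []                   []             = z≤n
unique-⊆⇒length≤ p (x≢xs ∷ unique) (x∈p ∷ xs⊆p) = ℕ.≤-trans
  (s≤s (unique-⊆⇒length≤ (p - _) unique
         (All.zipWith (λ (x≢y , y∈p) → x∈p∧x≢y⇒x∈p-y y∈p (x≢y ∘ ≡.sym)) (x≢xs , xs⊆p))))
  (x∈p⇒∣p-x∣<∣p∣ x∈p)

-- Amortised accounting of the queries.

module Arithmetic where
  open import Data.Nat.Base using (_+_; _*_)
  open ℕ.≤-Reasoning
  open +-*-Solver

  -- The witness is the root rounded up; the factor 4 absorbs the rounding, since √n + 1 ≤ 2 √n for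
  -- n ≥ 1.
  ceilSqrt : ∀ n → ∃ λ r → n ≤ r * r × r * r ≤ 4 * n
  ceilSqrt zero    = 0 , z≤n , z≤n
  ceilSqrt (suc n) with ceilSqrt n
  ... | r , n≤r² , r²≤4n with suc n ℕ.≤? r * r
  ...   | yes n<r² = r , n<r² , ℕ.≤-trans r²≤4n (ℕ.*-monoʳ-≤ 4 (ℕ.n≤1+n n))
  ...   | no  n≮r² = suc r , lower , upper
    where
    r≤r*r : ∀ r → r ≤ r * r
    r≤r*r zero    = z≤n
    r≤r*r (suc r) = ℕ.m≤m*n (suc r) (suc r)
    r²≤n : r * r ≤ n
    r²≤n = ℕ.≤-pred (ℕ.≰⇒> n≮r²)
    lower : suc n ≤ suc r * suc r
    lower = begin
      suc n                  ≤⟨ s≤s n≤r² ⟩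
      suc (r * r)            ≤⟨ ℕ.m≤m+n _ (r + r) ⟩
      suc (r * r) + (r + r)  ≡⟨ solve 1 (λ r → con 1 :+ r :* r :+ (r :+ r) := (con 1 :+ r) :* (con 1 :+ r)) ≡.refl r ⟩
      suc r * suc r          ∎
    upper : suc r * suc r ≤ 4 * suc n
    upper = begin
      suc r * suc r          ≡⟨ solve 1 (λ r → (con 1 :+ r) :* (con 1 :+ r) := con 1 :+ (r :+ r :+ r :* r)) ≡.refl r ⟩
      suc (r + r + r * r)    ≤⟨ s≤s (ℕ.+-mono-≤ (ℕ.+-mono-≤ r≤n r≤n) r²≤n) ⟩
      suc (n + n + n)        ≤⟨ ℕ.m≤m+n _ (3 + n) ⟩
      suc (n + n + n) + (3 + n) ≡⟨ solve 1 (λ n → con 1 :+ (n :+ n :+ n) :+ (con 3 :+ n) := con 4 :* (con 1 :+ n)) ≡.refl n ⟩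
      4 * suc n              ∎
      where
      r≤n = ℕ.≤-trans (r≤r*r r) r²≤n

  square-cancel-≤ : ∀ {a b} → a * a ≤ b * b → a ≤ b
  square-cancel-≤ {a} {b} a²≤b² with a ℕ.≤? b
  ... | yes a≤b = a≤b
  ... | no  a≰b = contradiction (ℕ.≤-<-trans a²≤b² (ℕ.*-mono-< (ℕ.≰⇒> a≰b) (ℕ.≰⇒> a≰b))) (ℕ.<-irrefl ≡.refl)

  2ab≤a²+b² : ∀ a b → 2 * (a * b) ≤ a * a + b * b
  2ab≤a²+b² a b with ℕ.≤-total a b
  ... | inj₁ a≤b with ℕ.m≤n⇒∃[o]m+o≡n a≤b
  ...   | d , ≡.refl = ℕ.m+n≤o⇒m≤o _ (ℕ.≤-reflexive (solve 2 (λ a d → con 2 :* (a :* (a :+ d)) :+ d :* d := a :* a :+ (a :+ d) :* (a :+ d)) ≡.refl a d))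
  2ab≤a²+b² a b | inj₂ b≤a with ℕ.m≤n⇒∃[o]m+o≡n b≤a
  ...   | d , ≡.refl = ℕ.m+n≤o⇒m≤o _ (ℕ.≤-reflexive (solve 2 (λ b d → con 2 :* ((b :+ d) :* b) :+ d :* d := (b :+ d) :* (b :+ d) :+ b :* b) ≡.refl b d))

  [a+b]²≤2a²+2b² : ∀ a b → (a + b) * (a + b) ≤ 2 * (a * a) + 2 * (b * b)
  [a+b]²≤2a²+2b² a b = begin
    (a + b) * (a + b)                ≡⟨ solve 2 (λ a b → (a :+ b) :* (a :+ b) := a :* a :+ b :* b :+ con 2 :* (a :* b)) ≡.refl a b ⟩
    a * a + b * b + 2 * (a * b)      ≤⟨ ℕ.+-monoʳ-≤ (a * a + b * b) (2ab≤a²+b² a b) ⟩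
    a * a + b * b + (a * a + b * b)  ≡⟨ solve 2 (λ x y → x :+ y :+ (x :+ y) := con 2 :* x :+ con 2 :* y) ≡.refl (a * a) (b * b) ⟩
    2 * (a * a) + 2 * (b * b)        ∎

  -- The weight 3/2 on a² stays below the factor p ≥ 2 by which a miss enlarges m. The symmetric
  -- weight 2 would leave no room for the cost of the new cofactor.
  2[a+b]²≤3a²+6b² : ∀ a b → 2 * ((a + b) * (a + b)) ≤ 3 * (a * a) + 6 * (b * b)
  2[a+b]²≤3a²+6b² a b = begin
    2 * ((a + b) * (a + b))                ≡⟨ solve 2 (λ a b → con 2 :* ((a :+ b) :* (a :+ b)) := con 2 :* (a :* a) :+ con 2 :* (b :* b) :+ con 2 :* (a :* (con 2 :* b))) ≡.refl a b ⟩
    2 * (a * a) + 2 * (b * b) + 2 * (a * (2 * b))      ≤⟨ ℕ.+-monoʳ-≤ (2 * (a * a) + 2 * (b * b)) (2ab≤a²+b² a (2 * b)) ⟩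
    2 * (a * a) + 2 * (b * b) + (a * a + 2 * b * (2 * b))  ≡⟨ solve 2 (λ a b → con 2 :* (a :* a) :+ con 2 :* (b :* b) :+ (a :* a :+ con 2 :* b :* (con 2 :* b)) := con 3 :* (a :* a) :+ con 6 :* (b :* b)) ≡.refl a b ⟩
    3 * (a * a) + 6 * (b * b)        ∎

  -- The balancing length √(m (k + 1)), rounded up, but never below the `x` answers already paid for
  -- and never beyond the `m` elements available.
  prefixLength : ℕ → ℕ → ℕ → ℕ
  prefixLength m k x = m ⊓ (x ⊔ proj₁ (ceilSqrt (m * suc k)))

  module _ {m k x : ℕ} where

    private
      r = proj₁ (ceilSqrt (m * suc k))
      n≤r² = proj₁ (proj₂ (ceilSqrt (m * suc k)))
      r²≤4n = proj₂ (proj₂ (ceilSqrt (m * suc k)))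

    prefixLength≤ : prefixLength m k x ≤ m
    prefixLength≤ = ℕ.m⊓n≤m m _

    prefixLength≥ : x ≤ m → x ≤ prefixLength m k x
    prefixLength≥ x≤m = ℕ.⊓-glb x≤m (ℕ.m≤m⊔n x r)

    prefixLength>0 : 0 < m → 0 < prefixLength m k x
    prefixLength>0 0<m = ℕ.⊓-glb 0<m (ℕ.<-≤-trans 0<r (ℕ.m≤n⊔m x r))
      where
      0<r : 0 < r
      0<r with r | n≤r²
      ... | zero  | m*suc-k≤0 = contradiction (ℕ.<-≤-trans (ℕ.*-mono-< 0<m (z<s {k})) m*suc-k≤0) (λ ())
      ... | suc _ | _ = z<s

    prefixLength²≤ : x * x ≤ 4 * (m * suc k) → prefixLength m k x * prefixLength m k x ≤ 4 * (m * suc k)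
    prefixLength²≤ x²≤ with ℕ.⊔-sel x r
    ... | inj₁ eq rewrite eq = ℕ.≤-trans (ℕ.*-mono-≤ (ℕ.m⊓n≤n m x) (ℕ.m⊓n≤n m x)) x²≤
    ... | inj₂ eq rewrite eq = ℕ.≤-trans (ℕ.*-mono-≤ (ℕ.m⊓n≤n m r) (ℕ.m⊓n≤n m r)) r²≤4n

    prefixLength-long : prefixLength m k x ≡ m ⊎ m * suc k ≤ prefixLength m k x * prefixLength m k x
    prefixLength-long with ℕ.⊓-sel m (x ⊔ r)
    ... | inj₁ eq = inj₁ eq
    ... | inj₂ eq = inj₂ (≡.subst (λ y → m * suc k ≤ y * y) (≡.sym eq)
                      (ℕ.≤-trans n≤r² (ℕ.*-mono-≤ (ℕ.m≤n⊔m x r) (ℕ.m≤n⊔m x r))))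

  -- A prefix that is the whole spread leaves `s * m ≤ 4 * m`. Any other has a square of at least
  -- `m * suc k`, and squaring `s * y ≤ 4 * m` gives the second alternative.
  cofactor-bound : ∀ {m k x s} → 0 < m → s * prefixLength m k x ≤ 4 * m → s ≤ 4 ⊎ s * s * suc k ≤ 16 * m
  cofactor-bound {m} {k} {x} {s} 0<m sx≤4m with prefixLength m k x | prefixLength-long {m} {k} {x}
  ... | y | inj₁ ≡.refl  = inj₁ (ℕ.*-cancelʳ-≤ s 4 m {{ℕ.>-nonZero 0<m}} sx≤4m)
  ... | y | inj₂ mκ≤y² = inj₂ (ℕ.*-cancelʳ-≤ (s * s * suc k) (16 * m) m {{ℕ.>-nonZero 0<m}} (begin
    s * s * suc k * m        ≡⟨ solve 3 (λ s k m → s :* s :* k :* m := s :* s :* (m :* k)) ≡.refl s (suc k) m ⟩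
    s * s * (m * suc k)      ≤⟨ ℕ.*-monoʳ-≤ (s * s) mκ≤y² ⟩
    s * s * (y * y)          ≡⟨ solve 2 (λ s y → s :* s :* (y :* y) := s :* y :* (s :* y)) ≡.refl s y ⟩
    s * y * (s * y)          ≤⟨ ℕ.*-mono-≤ sx≤4m sx≤4m ⟩
    4 * m * (4 * m)          ≡⟨ solve 1 (λ m → con 4 :* m :* (con 4 :* m) := con 16 :* m :* m) ≡.refl m ⟩
    16 * m * m               ∎))

  cofactor²≤16m : ∀ {m k s} → 0 < m → s ≤ 4 ⊎ s * s * suc k ≤ 16 * m → s * s ≤ 16 * m
  cofactor²≤16m {m} 0<m (inj₁ s≤4) = ℕ.≤-trans (ℕ.*-mono-≤ s≤4 s≤4) (ℕ.m≤m*n 16 m {{ℕ.>-nonZero 0<m}})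
  cofactor²≤16m {m} {k} {s} 0<m (inj₂ s²κ≤16m) = ℕ.≤-trans (ℕ.m≤m*n (s * s) (suc k)) s²κ≤16m

  -- The queries made so far: x to the prefix of the spread, a + b to cofactors,
  -- where b collects the constant cost of the k discoveries at which the
  -- prefix was the whole spread.  The bounds are on squares because then a miss
  -- (m is multiplied by p ≥ 2) and a hit (k grows) both pay for one more cofactor
  -- of size s with s² ≤ 16 m, respectively s² (k + 1) ≤ 16 m, if 144 is the constant.
  record Ledger (m k x a b : ℕ) : Set where
    field
      x≤m  : x ≤ m
      x²≤  : x * x ≤ 4 * (m * suc k)
      a²≤  : a * a ≤ 144 * (m * suc k)
      b≤   : b ≤ 4 * k

  module _ {m k x a b : ℕ} (ledger : Ledger m k x a b) (0<m : 0 < m) where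

    open Ledger ledger

    ledger-prefix : Ledger m k (prefixLength m k x) a b
    ledger-prefix = record { x≤m = prefixLength≤ {m} {k} {x} ; x²≤ = prefixLength²≤ {m} {k} {x} x²≤ ; a²≤ = a²≤ ; b≤ = b≤ }

    -- Already p = 2 pays: in multiples of m (k + 1), twice the new square is at most 3 · 144 + 6 ·
    -- 16 = 528, while 2 · 144 · 2 = 576 is available.
    ledger-miss : ∀ {s p} → s * s ≤ 16 * m → 2 ≤ p → Ledger (p * m) k x (a + s) b
    ledger-miss {s} {p} s²≤16m 2≤p = record
      { x≤m = ℕ.≤-trans x≤m m≤pm
      ; x²≤ = ℕ.≤-trans x²≤ (ℕ.*-monoʳ-≤ 4 (ℕ.*-monoˡ-≤ (suc k) m≤pm))
      ; a²≤ = ℕ.*-cancelˡ-≤ 2 (begin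
          2 * ((a + s) * (a + s))                      ≤⟨ 2[a+b]²≤3a²+6b² a s ⟩
          3 * (a * a) + 6 * (s * s)                    ≤⟨ ℕ.+-mono-≤ (ℕ.*-monoʳ-≤ 3 a²≤) (ℕ.*-monoʳ-≤ 6 (ℕ.≤-trans s²≤16m (ℕ.*-monoʳ-≤ 16 (ℕ.m≤m*n m (suc k))))) ⟩
          3 * (144 * n) + 6 * (16 * n)                 ≤⟨ ℕ.m≤m+n _ (48 * n) ⟩
          3 * (144 * n) + 6 * (16 * n) + 48 * n        ≡⟨ solve 1 (λ n → con 3 :* (con 144 :* n) :+ con 6 :* (con 16 :* n) :+ con 48 :* n := con 2 :* (con 144 :* (con 2 :* n))) ≡.refl n ⟩
          2 * (144 * (2 * n))                          ≤⟨ ℕ.*-monoʳ-≤ 2 (ℕ.*-monoʳ-≤ 144 (ℕ.*-monoˡ-≤ n 2≤p)) ⟩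
          2 * (144 * (p * n))                          ≡⟨ ≡.cong (λ z → 2 * (144 * z)) (ℕ.*-assoc p m (suc k)) ⟨
          2 * (144 * (p * m * suc k))                  ∎)
      ; b≤  = b≤
      }
      where
      n = m * suc k
      m≤pm : m ≤ p * m
      m≤pm = ℕ.m≤n*m m p {{ℕ.>-nonZero (ℕ.<-≤-trans z<s 2≤p)}}

    -- Only k grows here, so a bounded cofactor is charged to `b`. In the other case a² s² ≤ 144 ·
    -- 16 m², whose root is exact: a s ≤ 48 m. The square of `a` then grows by at most (2 · 48 + 16)
    -- m = 112 m, and raising k by one allows 144 m.
    ledger-hit : ∀ {s} → s ≤ 4 ⊎ s * s * suc k ≤ 16 * m → ∃₂ λ a′ b′ → Ledger m (suc k) x a′ b′ × a′ + b′ ≡ s + (a + b)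
    ledger-hit {s} = λ where
        (inj₁ s≤4) → a , s + b , record { x≤m = x≤m ; x²≤ = x²≤′ ; a²≤ = ℕ.≤-trans a²≤ (ℕ.*-monoʳ-≤ 144 n≤n′)
            ; b≤ = ℕ.≤-trans (ℕ.+-mono-≤ s≤4 b≤) (ℕ.≤-reflexive (≡.sym (ℕ.*-suc 4 k))) }
          , solve 3 (λ a s b → a :+ (s :+ b) := s :+ (a :+ b)) ≡.refl a s b
        (inj₂ s²κ≤16m) → s + a , b , record { x≤m = x≤m ; x²≤ = x²≤′ ; a²≤ = [s+a]²≤ s²κ≤16m
            ; b≤ = ℕ.≤-trans b≤ (ℕ.*-monoʳ-≤ 4 (ℕ.n≤1+n k)) }
          , ℕ.+-assoc s a b
      where
      n≤n′ : m * suc k ≤ m * suc (suc k)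
      n≤n′ = ℕ.*-monoʳ-≤ m (ℕ.n≤1+n (suc k))
      x²≤′ = ℕ.≤-trans x²≤ (ℕ.*-monoʳ-≤ 4 n≤n′)
      [s+a]²≤ : s * s * suc k ≤ 16 * m → (s + a) * (s + a) ≤ 144 * (m * suc (suc k))
      [s+a]²≤ s²κ≤16m = begin
        (s + a) * (s + a)                          ≡⟨ solve 2 (λ s a → (s :+ a) :* (s :+ a) := a :* a :+ con 2 :* (a :* s) :+ s :* s) ≡.refl s a ⟩
        a * a + 2 * (a * s) + s * s                ≤⟨ ℕ.+-mono-≤ (ℕ.+-mono-≤ a²≤ (ℕ.*-monoʳ-≤ 2 as≤48m)) (cofactor²≤16m {m} {k} {s} 0<m (inj₂ s²κ≤16m)) ⟩
        144 * (m * suc k) + 2 * (48 * m) + 16 * m  ≤⟨ ℕ.m≤m+n _ (32 * m) ⟩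
        144 * (m * suc k) + 2 * (48 * m) + 16 * m + 32 * m ≡⟨ solve 2 (λ m k → con 144 :* (m :* k) :+ con 2 :* (con 48 :* m) :+ con 16 :* m :+ con 32 :* m := con 144 :* (m :* (con 1 :+ k))) ≡.refl m (suc k) ⟩
        144 * (m * suc (suc k))                    ∎
        where
        as≤48m : a * s ≤ 48 * m
        as≤48m = square-cancel-≤ (begin
          a * s * (a * s)                ≡⟨ solve 2 (λ a s → a :* s :* (a :* s) := a :* a :* (s :* s)) ≡.refl a s ⟩
          a * a * (s * s)                ≤⟨ ℕ.*-monoˡ-≤ (s * s) a²≤ ⟩
          144 * (m * suc k) * (s * s)    ≡⟨ solve 3 (λ m k s → con 144 :* (m :* k) :* (s :* s) := con 144 :* m :* (s :* s :* k)) ≡.refl m (suc k) s ⟩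
          144 * m * (s * s * suc k)      ≤⟨ ℕ.*-monoʳ-≤ (144 * m) s²κ≤16m ⟩
          144 * m * (16 * m)             ≡⟨ solve 1 (λ m → con 144 :* m :* (con 16 :* m) := con 48 :* m :* (con 48 :* m)) ≡.refl m ⟩
          48 * m * (48 * m)              ∎)

    -- Origin of the constant 26: 2 · 4 + 2 · 144 = 296, doubled because k + 1 ≤ 2 (1 ⊔ k), is 592,
    -- and 26² = 676 is a square above it.
    ledger-total : (x + a) * (x + a) ≤ 26 * 26 * (m * (1 ⊔ k))
    ledger-total = begin
      (x + a) * (x + a)                              ≤⟨ [a+b]²≤2a²+2b² x a ⟩
      2 * (x * x) + 2 * (a * a)                      ≤⟨ ℕ.+-mono-≤ (ℕ.*-monoʳ-≤ 2 x²≤) (ℕ.*-monoʳ-≤ 2 a²≤) ⟩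
      2 * (4 * (m * suc k)) + 2 * (144 * (m * suc k)) ≡⟨ solve 1 (λ n → con 2 :* (con 4 :* n) :+ con 2 :* (con 144 :* n) := con 296 :* n) ≡.refl (m * suc k) ⟩
      296 * (m * suc k)                              ≤⟨ ℕ.*-monoʳ-≤ 296 (ℕ.*-monoʳ-≤ m (ℕ.+-mono-≤ (ℕ.m≤m⊔n 1 k) (ℕ.m≤n⊔m 1 k))) ⟩
      296 * (m * (q + q))                            ≤⟨ ℕ.m≤m+n _ (84 * (m * q)) ⟩
      296 * (m * (q + q)) + 84 * (m * q)             ≡⟨ solve 2 (λ m q → con 296 :* (m :* (q :+ q)) :+ con 84 :* (m :* q) := con 676 :* (m :* q)) ≡.refl m q ⟩
      676 * (m * q)                                  ∎
      where q = 1 ⊔ k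

  -- For the decision algorithm. Its first hit ends the run, so neither m nor k grows any more to
  -- pay for the last cofactor, and `s` is added by hand; `s = 0` serves a run without hits.
  ledger-total₀ : ∀ {m x a b s} → Ledger m 0 x a b → s * s ≤ 16 * m → (x + (s + (a + b))) * (x + (s + (a + b))) ≤ 26 * 26 * m
  ledger-total₀ {m} {x} {a} {b} {s} ledger s²≤16m with Ledger.b≤ ledger
  ... | z≤n = begin
    (x + (s + (a + 0))) * (x + (s + (a + 0)))       ≡⟨ solve 3 (λ x s a → (x :+ (s :+ (a :+ con 0))) :* (x :+ (s :+ (a :+ con 0))) := (a :+ (x :+ s)) :* (a :+ (x :+ s))) ≡.refl x s a ⟩
    (a + (x + s)) * (a + (x + s))                   ≤⟨ [a+b]²≤2a²+2b² a (x + s) ⟩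
    2 * (a * a) + 2 * ((x + s) * (x + s))           ≤⟨ ℕ.+-monoʳ-≤ (2 * (a * a)) (ℕ.*-monoʳ-≤ 2 ([a+b]²≤2a²+2b² x s)) ⟩
    2 * (a * a) + 2 * (2 * (x * x) + 2 * (s * s))   ≤⟨ ℕ.+-mono-≤ (ℕ.*-monoʳ-≤ 2 a²≤) (ℕ.*-monoʳ-≤ 2 (ℕ.+-mono-≤ (ℕ.*-monoʳ-≤ 2 x²≤) (ℕ.*-monoʳ-≤ 2 s²≤16m))) ⟩
    2 * (144 * (m * 1)) + 2 * (2 * (4 * (m * 1)) + 2 * (16 * m)) ≤⟨ ℕ.m≤m+n _ (308 * m) ⟩
    2 * (144 * (m * 1)) + 2 * (2 * (4 * (m * 1)) + 2 * (16 * m)) + 308 * m ≡⟨ solve 1 (λ m → con 2 :* (con 144 :* (m :* con 1)) :+ con 2 :* (con 2 :* (con 4 :* (m :* con 1)) :+ con 2 :* (con 16 :* m)) :+ con 308 :* m := con 676 :* m) ≡.refl m ⟩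
    26 * 26 * m                                     ∎
    where open Ledger ledger

  ledger-transfer : ∀ {x y s n n′ c d} → x + n ≡ y + (s + n′) → d ≡ s + c → y + n′ + d ≡ x + n + c
  ledger-transfer {x} {y} {s} {n} {n′} {c} eq ≡.refl rewrite eq =
    solve 4 (λ y n s c → y :+ n :+ (s :+ c) := y :+ (s :+ n) :+ c) ≡.refl y n′ s c

-- From inequalities between naturals to the real bounds.

module RealBounds where

  ι : ℕ → ℚ
  ι n = + n ℚ./ 1

  toℚᵘ-ι : ∀ n → toℚᵘ (ι n) ℚᵘ.≃ mkℚᵘ (+ n) 0
  toℚᵘ-ι n = ℚ.toℚᵘ-fromℚᵘ (mkℚᵘ (+ n) 0)

  ι-mono-≤ : ∀ {m n} → m ≤ n → ι m ℚ.≤ ι n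
  ι-mono-≤ {m} {n} m≤n = ℚ.toℚᵘ-cancel-≤ (begin
    toℚᵘ (ι m)        ≃⟨ toℚᵘ-ι m ⟩
    mkℚᵘ (+ m) 0      ≤⟨ ℚᵘ.*≤* (ℤ.*-monoʳ-≤-nonNeg (+ 1) (ℤ.+≤+ m≤n)) ⟩
    mkℚᵘ (+ n) 0      ≃⟨ toℚᵘ-ι n ⟨
    toℚᵘ (ι n)        ∎)
    where open ℚᵘ.≤-Reasoning

  ι-homo-+ : ∀ m n → ι (m ℕ.+ n) ≡ ι m ℚ.+ ι n
  ι-homo-+ m n = ℚ.toℚᵘ-injective (begin
    toℚᵘ (ι (m ℕ.+ n))                   ≈⟨ toℚᵘ-ι (m ℕ.+ n) ⟩
    mkℚᵘ (+ (m ℕ.+ n)) 0                 ≡⟨ ≡.cong (λ z → mkℚᵘ z 0) (≡.cong₂ ℤ._+_ (≡.sym (ℤ.*-identityʳ (+ m))) (≡.sym (ℤ.*-identityʳ (+ n)))) ⟩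
    mkℚᵘ (+ m) 0 ℚᵘ.+ mkℚᵘ (+ n) 0       ≈⟨ ℚᵘ.+-cong (toℚᵘ-ι m) (toℚᵘ-ι n) ⟨
    toℚᵘ (ι m) ℚᵘ.+ toℚᵘ (ι n)           ≈⟨ ℚ.toℚᵘ-homo-+ (ι m) (ι n) ⟨
    toℚᵘ (ι m ℚ.+ ι n)                   ∎)
    where open ℚᵘ.≃-Reasoning

  ι-homo-* : ∀ m n → ι (m ℕ.* n) ≡ ι m ℚ.* ι n
  ι-homo-* m n = ℚ.toℚᵘ-injective (begin
    toℚᵘ (ι (m ℕ.* n))                   ≈⟨ toℚᵘ-ι (m ℕ.* n) ⟩
    mkℚᵘ (+ (m ℕ.* n)) 0                 ≡⟨ ≡.cong (λ z → mkℚᵘ z 0) (ℤ.pos-* m n) ⟩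
    mkℚᵘ (+ m) 0 ℚᵘ.* mkℚᵘ (+ n) 0       ≈⟨ ℚᵘ.*-cong (toℚᵘ-ι m) (toℚᵘ-ι n) ⟨
    toℚᵘ (ι m) ℚᵘ.* toℚᵘ (ι n)           ≈⟨ ℚ.toℚᵘ-homo-* (ι m) (ι n) ⟨
    toℚᵘ (ι m ℚ.* ι n)                   ∎)
    where open ℚᵘ.≃-Reasoning

  [a/b]*b≡a : ∀ a b .{{_ : NonZero b}} → (+ a ℚ./ b) ℚ.* ι b ≡ ι a
  [a/b]*b≡a a b@(suc b-1) = ℚ.toℚᵘ-injective (begin
    toℚᵘ ((+ a ℚ./ b) ℚ.* ι b)           ≈⟨ ℚ.toℚᵘ-homo-* (+ a ℚ./ b) (ι b) ⟩
    toℚᵘ (+ a ℚ./ b) ℚᵘ.* toℚᵘ (ι b)     ≈⟨ ℚᵘ.*-cong (ℚ.toℚᵘ-fromℚᵘ (mkℚᵘ (+ a) b-1)) (toℚᵘ-ι b) ⟩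
    mkℚᵘ (+ a) b-1 ℚᵘ.* mkℚᵘ (+ b) 0     ≈⟨ ℚᵘ.*≡* (ℤ.*-assoc (+ a) (+ b) (+ 1)) ⟩
    mkℚᵘ (+ a) 0                         ≈⟨ toℚᵘ-ι a ⟨
    toℚᵘ (ι a)                           ∎)
    where open ℚᵘ.≃-Reasoning

  ι-nonNeg : ∀ n → ℚ.NonNegative (ι n)
  ι-nonNeg n = ℚ.normalize-nonNeg n 1

  square-cancel-≤ℚ : ∀ {p q} → 0ℚ ℚ.≤ q → p ℚ.* p ℚ.≤ q ℚ.* q → p ℚ.≤ q
  square-cancel-≤ℚ {p} {q} 0≤q p²≤q² with p ℚ.≤? q
  ... | yes p≤q = p≤q
  ... | no  p≰q = contradiction q²<q² (ℚ.<-irrefl ≡.refl)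
    where
    open ℚ.≤-Reasoning
    q<p = ℚ.≰⇒> p≰q
    instance
      _ = ℚ.nonNegative 0≤q
      _ = ℚ.positive (ℚ.≤-<-trans 0≤q q<p)
    q²<q² : q ℚ.* q ℚ.< q ℚ.* q
    q²<q² = begin-strict
      q ℚ.* q    ≤⟨ ℚ.*-monoˡ-≤-nonNeg q (ℚ.<⇒≤ q<p) ⟩
      q ℚ.* p    <⟨ ℚ.*-monoˡ-<-pos p q<p ⟩
      p ℚ.* p    ≤⟨ p²≤q² ⟩
      q ℚ.* q    ∎

  module _ (N C a b e : ℕ) .{{_ : NonZero b}} (N²b≤C²ae : N ℕ.* N ℕ.* b ≤ C ℕ.* C ℕ.* (a ℕ.* e)) where

    private instance
      _ = ι-nonNeg C
      _ = ι-nonNeg (C ℕ.* C)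
      _ = ℚ.normalize-pos b 1
      _ = ℚ.normalize-nonNeg a b

    -- Squaring removes the root: a bound `u` of it is known only through u², and the second factor
    -- under it only through its own bound `w`. The integer inequality divided by `b` therefore
    -- suffices.
    sqrt-bound : ∀ {w u} → ι e ℚ.≤ w → 0ℚ ℚ.≤ u → (+ a ℚ./ b) ℚ.* w ℚ.≤ u ℚ.* u → ι N ℚ.≤ ι C ℚ.* u
    sqrt-bound {w} {u} e≤w 0≤u [a/b]w≤u² = square-cancel-≤ℚ
      (≡.subst (ℚ._≤ ι C ℚ.* u) (ℚ.*-zeroʳ (ι C)) (ℚ.*-monoˡ-≤-nonNeg (ι C) 0≤u))
      (begin
        ι N ℚ.* ι N                        ≡⟨ ι-homo-* N N ⟨
        ι (N ℕ.* N)                        ≤⟨ ℚ.*-cancelʳ-≤-pos (ι b) scaled ⟩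
        ι (C ℕ.* C) ℚ.* (q ℚ.* ι e)        ≤⟨ ℚ.*-monoˡ-≤-nonNeg (ι (C ℕ.* C)) (ℚ.*-monoˡ-≤-nonNeg q e≤w) ⟩
        ι (C ℕ.* C) ℚ.* (q ℚ.* w)          ≤⟨ ℚ.*-monoˡ-≤-nonNeg (ι (C ℕ.* C)) [a/b]w≤u² ⟩
        ι (C ℕ.* C) ℚ.* (u ℚ.* u)          ≡⟨ ≡.cong (ℚ._* (u ℚ.* u)) (ι-homo-* C C) ⟩
        ι C ℚ.* ι C ℚ.* (u ℚ.* u)          ≡⟨ interchange (ι C) (ι C) u u ⟩
        ι C ℚ.* u ℚ.* (ι C ℚ.* u)          ∎)
      where
      open ℚ.≤-Reasoning
      open CommutativeSemigroupProperties (CommutativeMonoid.commutativeSemigroup ℚ.*-1-commutativeMonoid)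
        using (interchange; xy∙z≈xz∙y)
      q = + a ℚ./ b
      scaled : ι (N ℕ.* N) ℚ.* ι b ℚ.≤ ι (C ℕ.* C) ℚ.* (q ℚ.* ι e) ℚ.* ι b
      scaled = begin
        ι (N ℕ.* N) ℚ.* ι b                      ≡⟨ ι-homo-* (N ℕ.* N) b ⟨
        ι (N ℕ.* N ℕ.* b)                        ≤⟨ ι-mono-≤ N²b≤C²ae ⟩
        ι (C ℕ.* C ℕ.* (a ℕ.* e))                ≡⟨ ι-homo-* (C ℕ.* C) (a ℕ.* e) ⟩
        ι (C ℕ.* C) ℚ.* ι (a ℕ.* e)              ≡⟨ ≡.cong (ι (C ℕ.* C) ℚ.*_) (ι-homo-* a e) ⟩
        ι (C ℕ.* C) ℚ.* (ι a ℚ.* ι e)            ≡⟨ ≡.cong (λ z → ι (C ℕ.* C) ℚ.* (z ℚ.* ι e)) ([a/b]*b≡a a b) ⟨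
        ι (C ℕ.* C) ℚ.* (q ℚ.* ι b ℚ.* ι e)      ≡⟨ ≡.cong (ι (C ℕ.* C) ℚ.*_) (xy∙z≈xz∙y q (ι b) (ι e)) ⟩
        ι (C ℕ.* C) ℚ.* (q ℚ.* ι e ℚ.* ι b)      ≡⟨ ℚ.*-assoc (ι (C ℕ.* C)) (q ℚ.* ι e) (ι b) ⟨
        ι (C ℕ.* C) ℚ.* (q ℚ.* ι e) ℚ.* ι b      ∎

  ^-cancelʳ-≤ : ∀ b → 1 < b → ∀ {m n} → b ^ m ≤ b ^ n → m ≤ n
  ^-cancelʳ-≤ b 1<b {m} {n} b^m≤b^n with m ℕ.≤? n
  ... | yes m≤n = m≤n
  ... | no  m≰n = contradiction (ℕ.≤-<-trans b^m≤b^n (ℕ.^-monoʳ-< b 1<b (ℕ.≰⇒> m≰n))) (ℕ.<-irrefl ≡.refl)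

  -- For a bound c / d of the logarithm, 2 ^ (k d) ≤ n ^ d ≤ 2 ^ c, hence k d ≤ c.
  log₂-bound : ∀ {k n} .{{_ : NonZero n}} → 2 ^ k ≤ n → k ≤ʳ log₂ n
  log₂-bound {k} {n} 2^k≤n {t@(ℚ.mkℚ _ _ _)} (0≤t , n^d≤2^c) = ℚ.toℚᵘ-cancel-≤ (ℚᵘ.≤-trans (ℚᵘ.≤-reflexive (toℚᵘ-ι k)) (ℚᵘ.*≤* (begin
    + k ℤ.* ↧ t            ≡⟨ ℤ.pos-* k (↧ₙ t) ⟨
    + (k ℕ.* ↧ₙ t)         ≤⟨ ℤ.+≤+ kd≤c ⟩
    + ℤ.∣ ↥ t ∣            ≡⟨ ℤ.0≤i⇒+∣i∣≡i (ℤ.nonNegative⁻¹ (↥ t) {{ℚ.nonNegative 0≤t}}) ⟩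
    ↥ t                    ≡⟨ ℤ.*-identityʳ (↥ t) ⟨
    ↥ t ℤ.* (+ 1)          ∎)))
    where
    open ℤ.≤-Reasoning
    kd≤c : k ℕ.* ↧ₙ t ≤ ℤ.∣ ↥ t ∣
    kd≤c = ^-cancelʳ-≤ 2 (s≤s (s≤s z≤n)) (ℕ.≤-trans (ℕ.≤-reflexive (≡.sym (ℕ.^-*-assoc 2 k (↧ₙ t))))
             (ℕ.≤-trans (ℕ.^-monoˡ-≤ (↧ₙ t) 2^k≤n) n^d≤2^c))

  ≤ʳ-trans : ∀ m n r → m ≤ n → n ≤ʳ r → m ≤ʳ r
  ≤ʳ-trans m n r m≤n n≤r r∈ = ℚ.≤-trans (ι-mono-≤ m≤n) (n≤r r∈)

  decision-bound : ∀ N a b .{{_ : NonZero b}} → N ℕ.* N ℕ.* b ≤ 26 ℕ.* 26 ℕ.* a → N ≤ʳ fromℕ 26 *ʳ √ (a ÷ b)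
  decision-bound N a b N²b≤ (_ , u , ≡.refl , (0≤u , _ , ≡.refl , q≤u²) , ≡.refl) =
    sqrt-bound N 26 a b 1 (≡.subst (λ z → N ℕ.* N ℕ.* b ≤ 26 ℕ.* 26 ℕ.* z) (≡.sym (ℕ.*-identityʳ a)) N²b≤) ℚ.≤-refl 0≤u
      (≡.subst (ℚ._≤ u ℚ.* u) (≡.sym (ℚ.*-identityʳ _)) q≤u²)

  identification-bound : ∀ A k a b .{{_ : NonZero b}} → 2 ^ k ≤ b →
    A ℕ.* A ℕ.* b ≤ 26 ℕ.* 26 ℕ.* (a ℕ.* (1 ⊔ k)) →
    A ℕ.+ 4 ℕ.* k ≤ʳ fromℕ 26 *ʳ (√ ((a ÷ b) *ʳ (fromℕ 1 ⊔ʳ log₂ b)) +ʳ log₂ b)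
  -- The two occurrences of `log₂ b` come with independent bounds, `t` under the root and `v`
  -- outside it; `k` is below both.
  identification-bound A k a b 2^k≤b A²b≤
    (_ , _ , ≡.refl , (u , v , (0≤u , _ , (_ , _ , ≡.refl , (_ , t , ≡.refl , t∈ , ≡.refl) , ≡.refl) , ≤u²) , v∈ , ≡.refl) , ≡.refl) = begin
    ι (A ℕ.+ 4 ℕ.* k)               ≡⟨ ι-homo-+ A (4 ℕ.* k) ⟩
    ι A ℚ.+ ι (4 ℕ.* k)             ≤⟨ ℚ.+-mono-≤ (sqrt-bound A 26 a b (1 ⊔ k) A²b≤ 1⊔k≤1⊔t 0≤u ≤u²) (ι-mono-≤ (ℕ.*-monoˡ-≤ k (ℕ.m≤m+n 4 22))) ⟩
    ι 26 ℚ.* u ℚ.+ ι (26 ℕ.* k)     ≡⟨ ≡.cong (ι 26 ℚ.* u ℚ.+_) (ι-homo-* 26 k) ⟩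
    ι 26 ℚ.* u ℚ.+ ι 26 ℚ.* ι k     ≤⟨ ℚ.+-monoʳ-≤ (ι 26 ℚ.* u) (ℚ.*-monoˡ-≤-nonNeg (ι 26) (log₂-bound {k} {b} 2^k≤b v∈)) ⟩
    ι 26 ℚ.* u ℚ.+ ι 26 ℚ.* v       ≡⟨ ℚ.*-distribˡ-+ (ι 26) u v ⟨
    ι 26 ℚ.* (u ℚ.+ v)              ∎
    where
    open ℚ.≤-Reasoning
    1⊔k≤1⊔t : ι (1 ⊔ k) ℚ.≤ ι 1 ℚ.⊔ t
    1⊔k≤1⊔t with ℕ.⊔-sel 1 k
    ... | inj₁ eq rewrite eq = ℚ.p≤p⊔q (ι 1) t
    ... | inj₂ eq rewrite eq = ℚ.≤-trans (log₂-bound {k} {b} 2^k≤b t∈) (ℚ.p≤q⊔p (ι 1) t)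

-- Decidable subsets of the group and congruence modulo a subgroup.

module HiddenSubgroup (G : FiniteAbelianGroup) where

  open FiniteAbelianGroup G
  open AbelianGroupProperties abelianGroup
  open Arithmetic
  open RealBounds
  open Mult commutativeMonoid using ()
    renaming (_×_ to infixr 8 _·_; ×-homo-+ to ·-homo-+; ×-assocˡ to ·-assocˡ)

  element : Fin order → Carrier
  element = Inverse.from enumeration

  element∘index : ∀ x → element (index x) ≈ x
  element∘index x = Inverse.inverseʳ enumeration ≡.refl

  index∘element : ∀ i → index (element i) ≡ i
  index∘element i = Inverse.inverseˡ enumeration refl

  index-cong : ∀ {x y} → x ≈ y → index x ≡ index y
  index-cong = Inverse.to-cong enumeration

  index-injective : ∀ {x y} → index x ≡ index y → x ≈ y
  index-injective {x} {y} eq =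
    trans (sym (element∘index x)) (Inverse.inverseʳ enumeration eq)

  ∈-resp-≈ : ∀ {x y} (K : Subset order) → x ≈ y → x ∈ᴳ K → y ∈ᴳ K
  ∈-resp-≈ K x≈y = ≡.subst (_∈ K) (index-cong x≈y)

  _∈ᴳ?_ : ∀ x (K : Subset order) → Dec (x ∈ᴳ K)
  x ∈ᴳ? K = index x ∈? K

  module _ {P : Carrier → Set} (P? : Decidable P) (resp : ∀ {x y} → x ≈ y → P x → P y) where

    comprehension : Subset order
    comprehension = tabulate (does ∘ P? ∘ element)

    ∈-comprehension⁺ : ∀ {x} → P x → x ∈ᴳ comprehension
    ∈-comprehension⁺ {x} px = lookup⇒[]= _ _
      (≡.trans (lookup∘tabulate _ (index x))
               (dec-true (P? _) (resp (sym (element∘index x)) px)))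

    ∈-comprehension⁻ : ∀ {x} → x ∈ᴳ comprehension → P x
    ∈-comprehension⁻ {x} x∈ with P? (element (index x))
                               | ≡.trans (≡.sym (lookup∘tabulate (does ∘ P? ∘ element) (index x))) ([]=⇒lookup x∈)
    ... | yes p | _ = resp (element∘index x) p

  module _ (K : Subset order) (g : Carrier) (n : ℕ) where

    private
      P : Carrier → Set
      P x = ∃ λ a → a < n × (x ∙ (a · g) ⁻¹) ∈ᴳ K

      P? : Decidable P
      P? x = ℕ.anyUpTo? (λ a → (x ∙ (a · g) ⁻¹) ∈ᴳ? K) n

      resp : ∀ {x y} → x ≈ y → P x → P y
      resp x≈y (a , a<n , p) = a , a<n , ∈-resp-≈ K (∙-congʳ x≈y) p

    -- Restricting the multiples of `g` to digits below `n` makes membership decidable by bounded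
    -- search. `K` is an arbitrary subset because the algorithm also adjoins a discovered element to
    -- its record of H ∩ K.
    adjoin : Subset order
    adjoin = comprehension P? resp

    ∈-adjoin⁺ : ∀ {x} a → a < n → (x ∙ (a · g) ⁻¹) ∈ᴳ K → x ∈ᴳ adjoin
    ∈-adjoin⁺ a a<n p = ∈-comprehension⁺ P? resp (a , a<n , p)

    ∈-adjoin⁻ : ∀ {x} → x ∈ᴳ adjoin → ∃ λ a → a < n × (x ∙ (a · g) ⁻¹) ∈ᴳ K
    ∈-adjoin⁻ = ∈-comprehension⁻ P? resp

  module Modulo {K : Subset order} (K-isSubgroup : IsSubgroup K) where

    open IsSubgroup K-isSubgroup public

    infix 4 _∼_
    _∼_ : Carrier → Carrier → Set
    x ∼ y = (x ∙ y ⁻¹) ∈ᴳ K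

    ≈⇒∼ : ∀ {x y} → x ≈ y → x ∼ y
    ≈⇒∼ x≈y = ∈-resp-≈ K (sym (x≈y⇒x∙y⁻¹≈ε x≈y)) ε-closed

    ∼-sym : ∀ {x y} → x ∼ y → y ∼ x
    ∼-sym {x} {y} p = ∈-resp-≈ K (⁻¹-anti-homo-// x y) (⁻¹-closed p)

    private
      open CommutativeSemigroupProperties commutativeSemigroup using (interchange)
      telescope : ∀ x y z → (x ∙ y ⁻¹) ∙ (y ∙ z ⁻¹) ≈ x ∙ z ⁻¹
      telescope x y z = trans (sym (assoc _ _ _)) (∙-congʳ (//-rightDividesˡ y x))

    ∼-trans : ∀ {x y z} → x ∼ y → y ∼ z → x ∼ z
    ∼-trans {x} {y} {z} p q = ∈-resp-≈ K (telescope x y z) (∙-closed p q)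

    ∙-cong-∼ : ∀ {x y u v} → x ∼ y → u ∼ v → x ∙ u ∼ y ∙ v
    ∙-cong-∼ {x} {y} {u} {v} p q = ∈-resp-≈ K
      (trans (interchange x (y ⁻¹) u (v ⁻¹)) (∙-congˡ (⁻¹-∙-comm y v)))
      (∙-closed p q)

    ⁻¹-cong-∼ : ∀ {x y} → x ∼ y → x ⁻¹ ∼ y ⁻¹
    ⁻¹-cong-∼ {x} {y} p = ∈-resp-≈ K (sym (⁻¹-∙-comm x (y ⁻¹))) (⁻¹-closed p)

    -- Keeping the carrier and coarsening only the equality makes the general group lemmas and
    -- equational reasoning available modulo K, and likewise modulo H.
    quotient : AbelianGroup 0ℓ 0ℓ
    quotient = record
      { Carrier = Carrier ; _≈_ = _∼_ ; _∙_ = _∙_ ; ε = ε ; _⁻¹ = _⁻¹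
      ; isAbelianGroup = record
        { isGroup = record
          { isMonoid = record
            { isSemigroup = record
              { isMagma = record
                { isEquivalence = record
                  { refl = ≈⇒∼ refl ; sym = ∼-sym ; trans = ∼-trans }
                ; ∙-cong = ∙-cong-∼ }
              ; assoc = λ x y z → ≈⇒∼ (assoc x y z) }
            ; identity = (λ x → ≈⇒∼ (identityˡ x)) , (λ x → ≈⇒∼ (identityʳ x)) }
          ; inverse = (λ x → ≈⇒∼ (inverseˡ x)) , (λ x → ≈⇒∼ (inverseʳ x))
          ; ⁻¹-cong = ⁻¹-cong-∼ }
        ; comm = λ x y → ≈⇒∼ (comm x y) } }

    module Quotient = AbelianGroup quotient
    open Quotient public using ()
      renaming (refl to ∼-refl; ∙-congˡ to ∙-congˡ-∼; ∙-congʳ to ∙-congʳ-∼)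
    open AbelianGroupProperties quotient public using ()
      renaming (inverseʳ-unique to inverseʳ-unique-∼; ∙-cancelˡ to ∙-cancelˡ-∼)
    module ∼-Reasoning = SetoidReasoning Quotient.setoid

    ∈⇒∼ε : ∀ {x} → x ∈ᴳ K → x ∼ ε
    ∈⇒∼ε {x} = ∈-resp-≈ K (sym (trans (∙-congˡ ε⁻¹≈ε) (identityʳ x)))

    ∼ε⇒∈ : ∀ {x} → x ∼ ε → x ∈ᴳ K
    ∼ε⇒∈ {x} = ∈-resp-≈ K (trans (∙-congˡ ε⁻¹≈ε) (identityʳ x))

    ∈-resp-∼ : ∀ {x y} → x ∼ y → y ∈ᴳ K → x ∈ᴳ K
    ∈-resp-∼ x∼y y∈K = ∼ε⇒∈ (∼-trans x∼y (∈⇒∼ε y∈K))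

    ·-congʳ-∼ : ∀ n {x y} → x ∼ y → n · x ∼ n · y
    ·-congʳ-∼ zero    _   = ∼-refl
    ·-congʳ-∼ (suc n) x∼y = ∙-cong-∼ x∼y (·-congʳ-∼ n x∼y)

    ·ε∼ε : ∀ n {x} → x ∼ ε → n · x ∼ ε
    ·ε∼ε zero    _   = ∼-refl
    ·ε∼ε (suc n) x∼ε = ∼-trans (∙-cong-∼ x∼ε (·ε∼ε n x∼ε)) (≈⇒∼ (identityˡ ε))

    ·-∈ : ∀ n {x} → x ∈ᴳ K → (n · x) ∈ᴳ K
    ·-∈ n = ∼ε⇒∈ ∘ ·ε∼ε n ∘ ∈⇒∼ε

  -- Extensions of prime exponent and the chain of subgroups.

  module _ {K : Subset order} (K-isSubgroup : IsSubgroup K) where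

    open Modulo K-isSubgroup

    p·g∈K⇒[e*p]·g∼ε : ∀ {g} p e → (p · g) ∈ᴳ K → (e ℕ.* p) · g ∼ ε
    p·g∈K⇒[e*p]·g∼ε {g} p e p·g∈K = ∼-trans (≈⇒∼ (sym (·-assocˡ g e p))) (·ε∼ε e (∈⇒∼ε p·g∈K))

    -- This is why testing the single coset g ∙ K suffices.
    coset-multiple : ∀ {g x a p} → Prime p → (p · g) ∈ᴳ K → 0 < a → a < p → x ∼ a · g →
                     {H : Subset order} → IsSubgroup H → x ∈ᴳ H → ∃ λ h → h ∈ᴳ H × h ∼ g
    coset-multiple {g} {x} {a} {p} p-prime p·g∈K 0<a a<p x∼a·g {H} H-isSubgroup x∈H =
      -- Modulo p some multiple `c` of `a` is 1 or -1; accordingly `c · x` or its inverse, both in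
      -- H, is congruent to `g` modulo K.
      fromBézout (coprime-Bézout (Coprimality.sym (prime⇒coprime p-prime {{ℕ.>-nonZero 0<a}} a<p)))
      where
      module H = Modulo H-isSubgroup
      open ∼-Reasoning
      c·x∼ : ∀ c → c · x ∼ (c ℕ.* a) · g
      c·x∼ c = ∼-trans (·-congʳ-∼ c x∼a·g) (≈⇒∼ (·-assocˡ g c a))
      fromBézout : Bézout.Identity 1 a p → ∃ λ h → h ∈ᴳ H × h ∼ g
      fromBézout (Bézout.+- c e eq) = c · x , H.·-∈ c x∈H , (begin
        c · x                      ≈⟨ c·x∼ c ⟩
        (c ℕ.* a) · g              ≡⟨ ≡.cong (_· g) eq ⟨
        g ∙ (e ℕ.* p) · g          ≈⟨ ∙-congˡ-∼ (p·g∈K⇒[e*p]·g∼ε p e p·g∈K) ⟩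
        g ∙ ε                      ≈⟨ ≈⇒∼ (identityʳ g) ⟩
        g                          ∎)
      fromBézout (Bézout.-+ c e eq) = (c · x) ⁻¹ , H.⁻¹-closed (H.·-∈ c x∈H) , (begin
        (c · x) ⁻¹                 ≈⟨ ⁻¹-cong-∼ (c·x∼ c) ⟩
        ((c ℕ.* a) · g) ⁻¹         ≈⟨ inverseʳ-unique-∼ ((c ℕ.* a) · g) g (begin
          (c ℕ.* a) · g ∙ g          ≈⟨ ≈⇒∼ (comm _ _) ⟩
          suc (c ℕ.* a) · g          ≡⟨ ≡.cong (_· g) eq ⟩
          (e ℕ.* p) · g              ≈⟨ p·g∈K⇒[e*p]·g∼ε p e p·g∈K ⟩
          ε                          ∎) ⟨
        g                          ∎)

    module _ {g : Carrier} {p : ℕ} .{{_ : NonZero p}} (p·g∈K : (p · g) ∈ᴳ K) where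

      private
        K′ = adjoin K g p

      ∼·g⇒∈-adjoin : ∀ {x} n → x ∼ n · g → x ∈ᴳ K′
      ∼·g⇒∈-adjoin {x} n x∼n·g = ∈-adjoin⁺ K g p (n % p) (ℕ.m%n<n n p) (begin
        x                                ≈⟨ x∼n·g ⟩
        n · g                            ≡⟨ ≡.cong (_· g) (ℕ.m≡m%n+[m/n]*n n p) ⟩
        (n % p ℕ.+ n / p ℕ.* p) · g      ≈⟨ ≈⇒∼ (·-homo-+ g (n % p) (n / p ℕ.* p)) ⟩
        (n % p) · g ∙ (n / p ℕ.* p) · g  ≈⟨ ∙-congˡ-∼ (p·g∈K⇒[e*p]·g∼ε p (n / p) p·g∈K) ⟩
        (n % p) · g ∙ ε                  ≈⟨ ≈⇒∼ (identityʳ _) ⟩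
        (n % p) · g                      ∎)
        where open ∼-Reasoning

      ⊆-adjoin : ∀ {x} → x ∈ᴳ K → x ∈ᴳ K′
      ⊆-adjoin = ∼·g⇒∈-adjoin 0 ∘ ∈⇒∼ε

      generator∈adjoin : g ∈ᴳ K′
      generator∈adjoin = ∼·g⇒∈-adjoin 1 (≈⇒∼ (sym (identityʳ g)))

      adjoin-isSubgroup : IsSubgroup K′
      adjoin-isSubgroup = record
        { ε-closed  = ⊆-adjoin ε-closed
        ; ∙-closed  = ∙-adjoin
        ; ⁻¹-closed = ⁻¹-adjoin
        }
        where
        open ∼-Reasoning
        ∙-adjoin : ∀ {x y} → x ∈ᴳ K′ → y ∈ᴳ K′ → (x ∙ y) ∈ᴳ K′
        ∙-adjoin x∈ y∈ =
          let a , _ , x∼ = ∈-adjoin⁻ K g p x∈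
              b , _ , y∼ = ∈-adjoin⁻ K g p y∈
          in ∼·g⇒∈-adjoin (a ℕ.+ b) (∼-trans (∙-cong-∼ x∼ y∼) (≈⇒∼ (sym (·-homo-+ g a b))))
        ⁻¹-adjoin : ∀ {x} → x ∈ᴳ K′ → (x ⁻¹) ∈ᴳ K′
        ⁻¹-adjoin {x} x∈ =
          let a , a<p , x∼ = ∈-adjoin⁻ K g p x∈ in
          -- For `a = 0` this multiple is `p` itself, which is not a digit; `∼·g⇒∈-adjoin` reduces
          -- it modulo `p`.
          ∼·g⇒∈-adjoin (p ∸ a) (∼-trans (⁻¹-cong-∼ x∼) (∼-sym (inverseʳ-unique-∼ _ _ (begin
            a · g ∙ (p ∸ a) · g      ≈⟨ ≈⇒∼ (sym (·-homo-+ g a (p ∸ a))) ⟩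
            (a ℕ.+ (p ∸ a)) · g      ≡⟨ ≡.cong (_· g) (ℕ.m+[n∸m]≡n (ℕ.<⇒≤ a<p)) ⟩
            p · g                    ≈⟨ ∈⇒∼ε p·g∈K ⟩
            ε                        ∎))))

    -- Only the prime factors of the period matter later, so the crude one from a collision among
    -- the multiples 0 to `order` is enough.
    torsion : ∀ x → ∃ λ n → n · x ≈ ε × NonZero n
    torsion x with Fin.pigeonhole (ℕ.n<1+n order) (λ i → index (toℕ i · x))
    ... | i , j , i<j , eq = toℕ j ∸ toℕ i , identityʳ-unique (toℕ i · x) _ (begin
        toℕ i · x ∙ (toℕ j ∸ toℕ i) · x   ≈⟨ ·-homo-+ x (toℕ i) _ ⟨
        (toℕ i ℕ.+ (toℕ j ∸ toℕ i)) · x   ≡⟨ ≡.cong (_· x) (ℕ.m+[n∸m]≡n (ℕ.<⇒≤ i<j)) ⟩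
        toℕ j · x                         ≈⟨ index-injective eq ⟨
        toℕ i · x                         ∎) , ℕ.>-nonZero (ℕ.m<n⇒0<n∸m i<j)
      where open SetoidReasoning setoid

    record PrimeExtension : Set where
      field
        generator   : Carrier
        exponent    : ℕ
        isPrime     : Prime exponent
        generator∉K : ¬ generator ∈ᴳ K
        multiple∈K  : (exponent · generator) ∈ᴳ K

    -- Primes are stripped from the multiplier until the remaining multiple of `g` falls outside K,
    -- at the latest when it is `g` itself. The prime whose removal does this becomes the exponent.
    primeExtension′ : ∀ ps → All Prime ps → ∀ g → ¬ g ∈ᴳ K → (product ps · g) ∈ᴳ K → PrimeExtension
    primeExtension′ [] [] g g∉K g∈K = contradiction (∈-resp-≈ K (identityʳ g) g∈K) g∉K
    primeExtension′ (p ∷ ps) (p-prime ∷ primes) g g∉K [p*ps]·g∈K with (product ps · g) ∈ᴳ? K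
    ... | yes ps·g∈K = primeExtension′ ps primes g g∉K ps·g∈K
    ... | no  ps·g∉K = record
      { generator   = product ps · g
      ; exponent    = p
      ; isPrime     = p-prime
      ; generator∉K = ps·g∉K
      ; multiple∈K  = ∈-resp-≈ K (sym (·-assocˡ g p (product ps))) [p*ps]·g∈K
      }

    primeExtension : ∀ {g} → ¬ g ∈ᴳ K → PrimeExtension
    primeExtension {g} g∉K with torsion g
    ... | n , n·g≈ε , n≢0 with factorise n {{n≢0}}
    ... | record { factors = ps ; isFactorisation = ≡.refl ; factorsPrime = primes } =
      primeExtension′ ps primes g g∉K (∈-resp-≈ K (sym n·g≈ε) ε-closed)

  -- The chain depends on G alone, so it is fixed before any query, and both algorithms and their
  -- correctness proofs are structural recursions on it.
  data Chain (K : Subset order) (K-isSubgroup : IsSubgroup K) : Set where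
    whole  : (∀ x → x ∈ᴳ K) → Chain K K-isSubgroup
    extend : ∀ g p (p-prime : Prime p) → ¬ g ∈ᴳ K → (p·g∈K : (p · g) ∈ᴳ K) →
             Chain (adjoin K g p) (adjoin-isSubgroup K-isSubgroup {{prime⇒nonZero p-prime}} p·g∈K) →
             Chain K K-isSubgroup

  chain : ∀ {K} (K-isSubgroup : IsSubgroup K) → Acc _⊃_ K → Chain K K-isSubgroup
  chain {K} K-isSubgroup (acc rec) with Fin.any? (λ i → ¬? (element i ∈ᴳ? K))
  ... | no  none = whole λ x → decidable-stable (x ∈ᴳ? K) λ x∉K →
    none (index x , x∉K ∘ ∈-resp-≈ K (element∘index x))
  ... | yes (i , x∉K) = extend generator exponent isPrime generator∉K multiple∈K
      (chain _ (rec ((λ {j} j∈K → ≡.subst (_∈ _) (index∘element j)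
                       (⊆-adjoin K-isSubgroup multiple∈K (≡.subst (_∈ K) (≡.sym (index∘element j)) j∈K)))
                    , index generator , generator∈adjoin K-isSubgroup multiple∈K , generator∉K)))
    where
    open PrimeExtension (primeExtension K-isSubgroup x∉K)
    instance _ = prime⇒nonZero isPrime

  -- Spreads: digit lists and their factorisations.

  open SetoidMembership setoid using () renaming (_∈_ to _∈ˡ_)

  -- The newest digit is the most significant one. Hence D is an initial segment of its shifts for n
  -- > 0, and a table of answers on a prefix of D remains one after a miss.
  shifts : Carrier → ℕ → List Carrier → List Carrier
  shifts g zero    D = []
  shifts g (suc n) D = D ++ map (g ∙_) (shifts g n D)

  length-shifts : ∀ g n D → length (shifts g n D) ≡ n ℕ.* length D
  length-shifts g zero    D = ≡.refl
  length-shifts g (suc n) D = ≡.trans (length-++ D)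
    (≡.cong (length D ℕ.+_) (≡.trans (length-map (g ∙_) (shifts g n D)) (length-shifts g n D)))

  module _ {g : Carrier} {D : List Carrier} where

    ∈-shifts⁺ : ∀ {n x d} a → a < n → d ∈ˡ D → x ≈ a · g ∙ d → x ∈ˡ shifts g n D
    ∈-shifts⁺ {suc n} {x} {d} zero _ d∈D x≈ =
      ∈-++⁺ˡ setoid (∈ˡ-resp-≈ setoid (sym (trans x≈ (identityˡ d))) d∈D)
    ∈-shifts⁺ {suc n} {x} {d} (suc a) (s<s a<n) d∈D x≈ =
      ∈-++⁺ʳ setoid D (∈ˡ-resp-≈ setoid (sym (trans x≈ (assoc g (a · g) d)))
        (∈-map⁺ setoid setoid ∙-congˡ (∈-shifts⁺ a a<n d∈D refl)))

    ∈-shifts⁻ : ∀ {x} n → x ∈ˡ shifts g n D → ∃₂ λ a d → a < n × d ∈ˡ D × x ≈ a · g ∙ d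
    ∈-shifts⁻ {x} (suc n) x∈ with ∈-++⁻ setoid D x∈
    ... | inj₁ x∈D = 0 , x , z<s , x∈D , sym (identityˡ x)
    ... | inj₂ x∈map with ∈-map⁻ setoid setoid x∈map
    ...   | y , y∈ , x≈g∙y with ∈-shifts⁻ n y∈
    ...     | a , d , a<n , d∈D , y≈ =
      suc a , d , s<s a<n , d∈D , trans x≈g∙y (trans (∙-congˡ y≈) (sym (assoc g (a · g) d)))

    -- Invariance under translation by `g` lets the smaller of two digits be cancelled, so D has
    -- only to be compared with itself and with its shifts by 0 < a < n. This serves both
    -- inequivalence modulo H and the distinctness of `found`.
    shifts-AllPairs : ∀ {R : Carrier → Carrier → Set} →
      (∀ {x y z} → y ≈ z → R x z → R x y) → (∀ {x y} → R x y → R (g ∙ x) (g ∙ y)) → AllPairs R D →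
      ∀ n → (∀ {a x y} → 0 < a → a < n → x ∈ˡ D → y ∈ˡ D → R x (a · g ∙ y)) → AllPairs R (shifts g n D)
    shifts-AllPairs resp shift R-D zero    R-shifts = []
    shifts-AllPairs {R} resp shift R-D (suc n) R-shifts = AllPairs.++⁺ R-D
      (AllPairs.map⁺ (AllPairs.map shift (shifts-AllPairs resp shift R-D n λ 0<a a<n → R-shifts 0<a (ℕ.m<n⇒m<1+n a<n))))
      (All.tabulateₛ setoid λ x∈D → All.tabulateₛ setoid λ y∈ → cross x∈D (∈-map⁻ setoid setoid y∈))
      where
      cross : ∀ {x y} → x ∈ˡ D → (∃ λ z → z ∈ˡ shifts g n D × y ≈ g ∙ z) → R x y
      cross x∈D (z , z∈ , y≈g∙z) =
        let a , d , a<n , d∈D , z≈ = ∈-shifts⁻ n z∈ in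
        resp (trans y≈g∙z (trans (∙-congˡ z≈) (sym (assoc g (a · g) d)))) (R-shifts z<s (s<s a<n) x∈D d∈D)

    shifts-split : ∀ {b n} → b ≤ n → ∃ λ E → shifts g n D ≡ shifts g b D ++ E
    shifts-split {n = n} z≤n = shifts g n D , ≡.refl
    shifts-split {suc b} {suc n} (s≤s b≤n) with shifts-split b≤n
    ... | E , eq = map (g ∙_) E , (begin
      D ++ map (g ∙_) (shifts g n D)                 ≡⟨ ≡.cong (λ z → D ++ map (g ∙_) z) eq ⟩
      D ++ map (g ∙_) (shifts g b D ++ E)            ≡⟨ ≡.cong (D ++_) (map-++ (g ∙_) (shifts g b D) E) ⟩
      D ++ (map (g ∙_) (shifts g b D) ++ map (g ∙_) E) ≡⟨ ++-assoc D _ _ ⟨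
      shifts g (suc b) D ++ map (g ∙_) E             ∎)
      where open ≡.≡-Reasoning

  take-shifts : ∀ {g D x} n .{{_ : NonZero n}} → x ≤ length D → take x (shifts g n D) ≡ take x D
  take-shifts {D = D} {x} (suc n) x≤∣D∣ = take-++ x D _ x≤∣D∣

  ∈-take-++ : ∀ {x n} {xs ys : List Carrier} → x ∈ˡ xs → length xs ≤ n → x ∈ˡ take n (xs ++ ys)
  ∈-take-++ (here x≈)  (s≤s _)  = here x≈
  ∈-take-++ (there x∈) (s≤s ≤n) = there (∈-take-++ x∈ ≤n)

  ∈-take⁻ : ∀ {x} n {xs : List Carrier} → x ∈ˡ take n xs → x ∈ˡ xs
  ∈-take⁻ (suc n) {_ ∷ _} (here x≈)  = here x≈
  ∈-take⁻ (suc n) {_ ∷ _} (there x∈) = there (∈-take⁻ n x∈)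

  -- Only covering matters: products may coincide or leave D. That the cofactor lies in K keeps
  -- every difference found by a test inside the coset g ∙ K.
  record Splitting (K : Subset order) (D : List Carrier) (x : ℕ) : Set where
    field
      cofactor  : List Carrier
      cofactor⊆ : ∀ {s} → s ∈ˡ cofactor → s ∈ᴳ K
      covers    : ∀ {d} → d ∈ˡ D → ∃₂ λ s t → s ∈ˡ cofactor × t ∈ˡ take x D × d ≈ s ∙ t
      small     : length cofactor ℕ.* x ≤ 4 ℕ.* length D

  -- The part of the data on D that the algorithm can hold without knowing H; that D is a
  -- transversal is recorded in `Invariant`.
  record Spread (K : Subset order) : Set where
    field
      list     : List Carrier
      nonEmpty : 0 < length list
      list⊆    : ∀ {d} → d ∈ˡ list → d ∈ᴳ K
      split    : ∀ x → 0 < x → x ≤ length list → Splitting K list x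

  open Spread

  widen : ∀ {K K′} → (∀ {x} → x ∈ᴳ K → x ∈ᴳ K′) → Spread K → Spread K′
  widen K⊆K′ D = record
    { list     = list D
    ; nonEmpty = nonEmpty D
    ; list⊆    = K⊆K′ ∘ list⊆ D
    ; split    = λ x 0<x x≤ → let open Splitting (split D x 0<x x≤) in record
      { cofactor = cofactor ; cofactor⊆ = K⊆K′ ∘ cofactor⊆ ; covers = covers ; small = small }
    }

  initialSpread : ∀ {K} → ε ∈ᴳ K → Spread K
  initialSpread {K} ε∈K = record
    { list     = [ ε ]
    ; nonEmpty = z<s
    ; list⊆    = λ { (here x≈ε) → ∈-resp-≈ K (sym x≈ε) ε∈K }
    ; split    = λ { (suc zero) _ _ → record
      { cofactor  = [ ε ]
      ; cofactor⊆ = λ { (here x≈ε) → ∈-resp-≈ K (sym x≈ε) ε∈K }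
      ; covers    = λ { (here d≈ε) → ε , ε , here refl , here refl , trans d≈ε (sym (identityˡ ε)) }
      ; small     = s≤s z≤n }
                   ; (suc (suc _)) _ (s≤s ()) }
    }

  module _ {K : Subset order} (K-isSubgroup : IsSubgroup K) {g : Carrier} (g∈K : g ∈ᴳ K) where

    open Modulo K-isSubgroup using (·-∈; ∙-closed)

    shifts⊆ : ∀ n {D} → (∀ {x} → x ∈ˡ D → x ∈ᴳ K) → ∀ {x} → x ∈ˡ shifts g n D → x ∈ᴳ K
    shifts⊆ n D⊆K x∈ = let a , d , _ , d∈D , x≈ = ∈-shifts⁻ n x∈ in
      ∈-resp-≈ K (sym x≈) (∙-closed (·-∈ a g∈K) (D⊆K d∈D))

  module _ {K : Subset order} (K-isSubgroup : IsSubgroup K) {g : Carrier} (g∈K : g ∈ᴳ K) {D : List Carrier} where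

    -- For x beyond ∣D∣ the prefix of length x contains the first b = x / ∣D∣
    -- shifts of D; the cofactor then only has to reach every b-th shift.
    splitting-long : ∀ p x → .{{_ : NonZero (length D)}} → length D ≤ x → x ≤ p ℕ.* length D →
                     Splitting K (shifts g p D) x
    splitting-long p x m≤x x≤p*m = record
      -- For `a < p` the quotient `a / b` goes to the cofactor and `a % b` to the prefix. The
      -- quotient can reach `p / b`, hence `suc`; the last block may overshoot digit `p`.
      { cofactor  = shifts (b · g) (suc (p / b)) [ ε ]
      ; cofactor⊆ = shifts⊆ K-isSubgroup (·-∈ b g∈K) (suc (p / b)) λ { (here x≈ε) → ∈-resp-≈ K (sym x≈ε) ε-closed }
      ; covers    = covers
      ; small     = ≡.subst₂ (λ s m → s ℕ.* x ≤ 4 ℕ.* m)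
          (≡.sym (≡.trans (length-shifts (b · g) (suc (p / b)) [ ε ]) (ℕ.*-identityʳ (suc (p / b)))))
          (≡.sym (length-shifts g p D)) (suc[p/b]*x≤4pm p m x x≤p*m)
      }
      where
      open Modulo K-isSubgroup using (·-∈; ε-closed)
      m = length D
      b = x / m
      instance
        b-nonZero : NonZero b
        b-nonZero = ℕ.>-nonZero (ℕ.m≥n⇒m/n>0 m≤x)
      b≤p : b ≤ p
      b≤p = ℕ.*-cancelʳ-≤ b p m (ℕ.≤-trans (ℕ.m/n*n≤m x m) x≤p*m)
      prefix : ∀ {y} → y ∈ˡ shifts g b D → y ∈ˡ take x (shifts g p D)
      prefix {y} y∈ = let E , eq = shifts-split b≤p in
        ≡.subst (λ xs → y ∈ˡ take x xs) (≡.sym eq)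
          (∈-take-++ y∈ (ℕ.≤-trans (ℕ.≤-reflexive (length-shifts g b D)) (ℕ.m/n*n≤m x m)))
      covers : ∀ {d} → d ∈ˡ shifts g p D → ∃₂ λ s t →
               s ∈ˡ shifts (b · g) (suc (p / b)) [ ε ] × t ∈ˡ take x (shifts g p D) × d ≈ s ∙ t
      covers {y} y∈ =
        let a , d , a<p , d∈D , y≈ = ∈-shifts⁻ p y∈ in
        (a / b) · b · g , (a % b) · g ∙ d ,
        ∈-shifts⁺ (a / b) (s≤s (ℕ./-monoˡ-≤ b (ℕ.<⇒≤ a<p))) (here refl) (sym (identityʳ _)) ,
        prefix (∈-shifts⁺ (a % b) (ℕ.m%n<n a b) d∈D refl) ,
        (begin
          y                                         ≈⟨ y≈ ⟩
          a · g ∙ d                                 ≡⟨ ≡.cong (λ n → n · g ∙ d) (≡.trans (ℕ.m≡m%n+[m/n]*n a b) (ℕ.+-comm (a % b) (a / b ℕ.* b))) ⟩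
          (a / b ℕ.* b ℕ.+ a % b) · g ∙ d           ≈⟨ ∙-congʳ (·-homo-+ g (a / b ℕ.* b) (a % b)) ⟩
          (a / b ℕ.* b) · g ∙ (a % b) · g ∙ d       ≈⟨ assoc _ _ _ ⟩
          (a / b ℕ.* b) · g ∙ ((a % b) · g ∙ d)     ≈⟨ ∙-congʳ (·-assocˡ g (a / b) b) ⟨
          (a / b) · b · g ∙ ((a % b) · g ∙ d)       ∎)
        where open SetoidReasoning setoid

    -- The prefix lies within the first copy of D, so the new digit goes entirely to the cofactor,
    -- which grows by the same factor `p` as D.
    splitting-short : ∀ p .{{_ : NonZero p}} x → x ≤ length D → Splitting K D x → Splitting K (shifts g p D) x
    splitting-short p x x≤m S = record
      { cofactor  = shifts g p cofactor
      ; cofactor⊆ = shifts⊆ K-isSubgroup g∈K p cofactor⊆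
      ; covers    = λ y∈ →
          let a , d , a<p , d∈D , y≈ = ∈-shifts⁻ p y∈
              s , t , s∈ , t∈ , d≈ = covers d∈D
          in a · g ∙ s , t , ∈-shifts⁺ a a<p s∈ refl ,
             ≡.subst (t ∈ˡ_) (≡.sym (take-shifts p x≤m)) t∈ ,
             trans y≈ (trans (∙-congˡ d≈) (sym (assoc _ _ _)))
      ; small     = begin
          length (shifts g p cofactor) ℕ.* x      ≡⟨ ≡.cong (ℕ._* x) (length-shifts g p cofactor) ⟩
          p ℕ.* length cofactor ℕ.* x             ≡⟨ ℕ.*-assoc p (length cofactor) x ⟩
          p ℕ.* (length cofactor ℕ.* x)           ≤⟨ ℕ.*-monoʳ-≤ p small ⟩
          p ℕ.* (4 ℕ.* length D)                  ≡⟨ solve 2 (λ p m → p :* (con 4 :* m) := con 4 :* (p :* m)) ≡.refl p (length D) ⟩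
          4 ℕ.* (p ℕ.* length D)                  ≡⟨ ≡.cong (4 ℕ.*_) (length-shifts g p D) ⟨
          4 ℕ.* length (shifts g p D)             ∎
      }
      where
      open Splitting S
      open ℕ.≤-Reasoning
      open +-*-Solver

  extendSpread : ∀ {K K′} → IsSubgroup K′ → (∀ {x} → x ∈ᴳ K → x ∈ᴳ K′) →
                 ∀ {g} → g ∈ᴳ K′ → ∀ p → .{{NonZero p}} → Spread K → Spread K′
  extendSpread {K} {K′} K′-isSubgroup K⊆K′ {g} g∈K′ p D₀ = record
    { list     = shifts g p (list D)
    ; nonEmpty = ℕ.<-≤-trans (nonEmpty D) (ℕ.≤-trans (ℕ.m≤n*m _ p) (ℕ.≤-reflexive (≡.sym (length-shifts g p (list D)))))
    ; list⊆    = shifts⊆ K′-isSubgroup g∈K′ p (list⊆ D)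
    ; split    = λ x 0<x x≤ → case ℕ.≤-total x (length (list D)) of λ where
        (inj₁ x≤m) → splitting-short K′-isSubgroup g∈K′ p x x≤m (split D x 0<x x≤m)
        (inj₂ m≤x) → splitting-long K′-isSubgroup g∈K′ p x {{ℕ.>-nonZero (nonEmpty D)}} m≤x
                       (≡.subst (x ≤_) (length-shifts g p (list D)) x≤)
    }
    where
    D : Spread K′
    D = widen K⊆K′ D₀

  -- Counting cosets of H.

  distinct⇒length≤ : ∀ {xs} (p : Subset order) → AllPairs (λ x y → ¬ x ≈ y) xs →
                     (∀ {x} → x ∈ˡ xs → x ∈ᴳ p) → length xs ≤ ∣ p ∣
  distinct⇒length≤ {xs} p distinct xs⊆p = ≡.subst (_≤ ∣ p ∣) (length-map index xs)
    (unique-⊆⇒length≤ p (AllPairs.map⁺ (AllPairs.map (_∘ index-injective) distinct))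
                        (All.map⁺ (All.tabulateₛ setoid xs⊆p)))

  module _ {H : Subset order} (H-isSubgroup : IsSubgroup H) where

    open Modulo H-isSubgroup

    distinctCosets : ∀ {xs hs} → AllPairs (λ x y → ¬ x ∼ y) xs → AllPairs (λ x y → ¬ x ≈ y) hs → (∀ {h} → h ∈ˡ hs → h ∈ᴳ H) →
                     AllPairs (λ x y → ¬ x ≈ y) (cartesianProductWith _∙_ xs hs)
    distinctCosets {[]}     {hs} []              hs-distinct hs⊆H = []
    distinctCosets {x ∷ xs} {hs} (x≁xs ∷ xs-≁) hs-distinct hs⊆H = AllPairs.++⁺
      (AllPairs.map⁺ (AllPairs.map (_∘ ∙-cancelˡ x _ _) hs-distinct))
      (distinctCosets xs-≁ hs-distinct hs⊆H)
      (All.map⁺ (All.tabulateₛ setoid λ {h} h∈ → products x≁xs λ {y} {h′} x≁y h′∈ x∙h≈y∙h′ →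
        x≁y (∼-trans (∼-sym (absorb x (hs⊆H h∈))) (∼-trans (≈⇒∼ x∙h≈y∙h′) (absorb y (hs⊆H h′∈))))))
      where
      absorb : ∀ y {h} → h ∈ᴳ H → y ∙ h ∼ y
      absorb y h∈H = ∼-trans (∙-congˡ-∼ (∈⇒∼ε h∈H)) (≈⇒∼ (identityʳ y))
      products : ∀ {ys} {P Q : Carrier → Set} → All Q ys → (∀ {y h} → Q y → h ∈ˡ hs → P (y ∙ h)) →
                 All P (cartesianProductWith _∙_ ys hs)
      products []         f = []
      products (qy ∷ qys) f = All.++⁺ (All.map⁺ (All.tabulateₛ setoid λ h∈ → f qy h∈)) (products qys f)

    -- Representatives of different cosets times the elements of H are pairwise distinct elements of
    -- G.
    cosets-bound : ∀ {xs} → AllPairs (λ x y → ¬ x ∼ y) xs → length xs ℕ.* ∣ H ∣ ≤ order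
    cosets-bound {xs} distinct = begin
      length xs ℕ.* ∣ H ∣                       ≡⟨ ≡.cong (length xs ℕ.*_) (≡.trans (length-map element (members H)) (length-members H)) ⟨
      length xs ℕ.* length hs                   ≡⟨ length-cartesianProductWith _∙_ xs hs ⟨
      length (cartesianProductWith _∙_ xs hs)   ≤⟨ distinct⇒length≤ full (distinctCosets distinct hs-distinct hs⊆H) (λ _ → ∈⊤) ⟩
      ∣ full {order} ∣                          ≡⟨ ∣⊤∣≡n order ⟩
      order                                     ∎
      where
      open ℕ.≤-Reasoning
      hs = map element (members H)
      hs-distinct : AllPairs (λ x y → ¬ x ≈ y) hs
      hs-distinct = AllPairs.map⁺ (AllPairs.map (λ {i} {j} i≢j eq → i≢j
        (≡.trans (≡.sym (index∘element i)) (≡.trans (index-cong eq) (index∘element j)))) (members-unique H))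
      hs⊆H : ∀ {h} → h ∈ˡ hs → h ∈ᴳ H
      hs⊆H = All.lookupₛ setoid (∈-resp-≈ H) (All.map⁺ (All.map (λ {i} → ≡.subst (_∈ H) (≡.sym (index∘element i))) (members⊆ H)))

  -- The query algorithms.

  open CommutativeSemigroupProperties ℕ.+-commutativeSemigroup using (xy∙z≈y∙xz)

  Answers : Set
  Answers = List (Carrier × ℕ)

  module _ {R : Set} where

    probe : List Carrier → (Answers → QueryAlgorithm Carrier R) → QueryAlgorithm Carrier R
    probe []       k = k []
    probe (q ∷ qs) k = query q λ a → probe qs λ as → k ((q , a) ∷ as)

  Match : Answers → Answers → Set
  Match U T = Any (λ u → Any (λ t → proj₂ u ≡ proj₂ t) T) U

  match? : ∀ U T → Dec (Match U T)
  match? U T = Any.any? (λ u → Any.any? (λ t → proj₂ u ℕ.≟ proj₂ t) T) U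

  difference : ∀ {U T} → Match U T → Carrier
  difference m = proj₁ (Any.lookup m) ∙ proj₁ (Any.lookup (Any.lookup-result m)) ⁻¹

  module _ {R : Set} (hit : Answers → Carrier → QueryAlgorithm Carrier R) (miss : Answers → QueryAlgorithm Carrier R) where

    -- The decision is an argument so that `outcome` can split on an arbitrary `Dec` together with
    -- the statement about the run.
    decideMatch : ∀ {U T} → Dec (Match U T) → QueryAlgorithm Carrier R
    decideMatch {T = T} (yes m) = hit T (difference m)
    decideMatch {T = T} (no _)  = miss T

  module _ {K : Subset order} (D : Spread K) (k x : ℕ) where

    prefix : ℕ
    prefix = prefixLength (length (list D)) k x

    splitting : Splitting K (list D) prefix
    splitting = split D prefix (prefixLength>0 (nonEmpty D)) (prefixLength≤ {length (list D)} {k} {x})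

    -- Finds an element of H ∩ (g ∙ K), if there is one, as g ∙ s ⁻¹ ∙ t ⁻¹ with
    -- t in a prefix of the spread D; T holds the answers on the first x elements.
    testCoset : {R : Set} → Carrier → Answers → (Answers → Carrier → QueryAlgorithm Carrier R) →
                (Answers → QueryAlgorithm Carrier R) → QueryAlgorithm Carrier R
    testCoset g T hit miss =
      probe (drop x (take prefix (list D))) λ T⁺ →
      probe (map (λ s → g ∙ s ⁻¹) (Splitting.cofactor splitting)) λ U →
      decideMatch hit miss (match? U (T ++ T⁺))

  module Step {K : Subset order} (K-isSubgroup : IsSubgroup K) {g : Carrier} {p : ℕ}
              (p-prime : Prime p) (p·g∈K : (p · g) ∈ᴳ K) where

    instance
      p-nonZero : NonZero p
      p-nonZero = prime⇒nonZero p-prime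

    K′ : Subset order
    K′ = adjoin K g p

    K⊆K′ : ∀ {y} → y ∈ᴳ K → y ∈ᴳ K′
    K⊆K′ = ⊆-adjoin K-isSubgroup p·g∈K

    spread-hit spread-miss : Spread K → Spread K′
    spread-hit  = widen K⊆K′
    spread-miss = extendSpread (adjoin-isSubgroup K-isSubgroup p·g∈K) K⊆K′ (generator∈adjoin K-isSubgroup p·g∈K) p

  identify : ∀ {K} {K-isSubgroup : IsSubgroup K} → Chain K K-isSubgroup →
             Spread K → ℕ → ℕ → Answers → Subset order → QueryAlgorithm Carrier (Subset order)
  identify (whole _) D k x T L = output L
  identify {K-isSubgroup = K-isSubgroup} (extend g p p-prime g∉K p·g∈K c) D k x T L = testCoset D k x g T
    (λ T′ h → identify c (spread-hit D) (suc k) (prefix D k x) T′ (adjoin L h p))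
    (λ T′   → identify c (spread-miss D) k (prefix D k x) T′ L)
    where open Step K-isSubgroup p-prime p·g∈K

  decideTrivial : ∀ {K} {K-isSubgroup : IsSubgroup K} → Chain K K-isSubgroup →
                  Spread K → ℕ → Answers → QueryAlgorithm Carrier Bool
  decideTrivial (whole _) D x T = output true
  decideTrivial {K-isSubgroup = K-isSubgroup} (extend g p p-prime g∉K p·g∈K c) D x T = testCoset D 0 x g T
    (λ T′ h → output false)
    (λ T′   → decideTrivial c (spread-miss D) (prefix D 0 x) T′)
    where open Step K-isSubgroup p-prime p·g∈K

  -- Correctness and cost for a given hidden subgroup.

  module Hidden (X : FiniteSet) (f : Carrier → FiniteSet.Carrier X)
                (H : Subgroup) (hidden : Subgroup.HiddenBy H f) where

    open Subgroup H renaming (subset to H̄; isSubgroup to H-isSubgroup) using (card; card-nonZero)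
    open Modulo H-isSubgroup

    answer : Carrier → ℕ
    answer y = FiniteSet.label X (f y)

    ∼⇒⊆coset : ∀ {y z w} → y ∼ z → Subgroup._∈-coset_ H w y → Subgroup._∈-coset_ H w z
    ∼⇒⊆coset {y} {z} {w} y∼z (h , h∈H , w≈y∙h) = w ∙ z ⁻¹ ,
      (∼-trans (≈⇒∼ w≈y∙h) (∼-trans (∙-congˡ-∼ (∈⇒∼ε h∈H)) (∼-trans (≈⇒∼ (identityʳ y)) y∼z))) ,
      sym (trans (sym (assoc z w (z ⁻¹))) (xyx⁻¹≈y z w))

    ∼⇒answer≡ : ∀ {y z} → y ∼ z → answer y ≡ answer z
    ∼⇒answer≡ {y} {z} y∼z = ≡.cong (FiniteSet.label X)
      (Equivalence.from (hidden y z) λ w → mk⇔ (∼⇒⊆coset y∼z) (∼⇒⊆coset (∼-sym y∼z)))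

    answer≡⇒∼ : ∀ {y z} → answer y ≡ answer z → y ∼ z
    answer≡⇒∼ {y} {z} eq =
      let h , h∈H , y≈z∙h = Equivalence.to (Equivalence.to (hidden y z) (label-injective eq) y) (ε , ε-closed , sym (identityʳ y)) in
      ∼-trans (≈⇒∼ y≈z∙h) (∼-trans (∙-congˡ-∼ (∈⇒∼ε h∈H)) (≈⇒∼ (identityʳ z)))
      where
      label-injective : ∀ {u v} → FiniteSet.label X u ≡ FiniteSet.label X v → u ≡ v
      label-injective {u} {v} eq′ = ≡.trans (≡.sym (Inverse.strictlyInverseʳ (FiniteSet.enumeration X) u))
        (≡.trans (≡.cong (Inverse.from (FiniteSet.enumeration X)) (Fin.toℕ-injective eq′)) (Inverse.strictlyInverseʳ (FiniteSet.enumeration X) v))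

    answers : List Carrier → Answers
    answers = map λ q → q , answer q

    module _ {R : Set} where

      result-probe : ∀ qs (k : Answers → QueryAlgorithm Carrier R) → result X f (probe qs k) ≡ result X f (k (answers qs))
      result-probe []       k = ≡.refl
      result-probe (q ∷ qs) k = result-probe qs _

      queries-probe : ∀ qs (k : Answers → QueryAlgorithm Carrier R) →
                      queries X f (probe qs k) ≡ length qs ℕ.+ queries X f (k (answers qs))
      queries-probe []       k = ≡.refl
      queries-probe (q ∷ qs) k = ≡.cong suc (queries-probe qs _)

    module _ {K : Subset order} (K-isSubgroup : IsSubgroup K) where

      private module K = Modulo K-isSubgroup

      -- `L` is H ∩ K, and `covers` with `distinct` makes D a transversal of it in K, as D lies in
      -- K. The list `found` holds the combinations of the discovered elements with coefficients 0
      -- and 1; it exists only to witness 2 ^ k ≤ ∣H∣.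
      record Invariant (D : Spread K) (k x : ℕ) (T : Answers) (L : Subset order) : Set where
        field
          table     : T ≡ answers (take x (list D))
          known⁺    : ∀ {y} → y ∈ᴳ H̄ → y ∈ᴳ K → y ∈ᴳ L
          known⁻    : ∀ {y} → y ∈ᴳ L → y ∈ᴳ H̄ × y ∈ᴳ K
          covers    : ∀ {y} → y ∈ᴳ K → ∃ λ d → d ∈ˡ list D × y ∼ d
          distinct  : AllPairs (λ y z → ¬ y ∼ z) (list D)
          found     : List Carrier
          found⊆    : ∀ {y} → y ∈ˡ found → y ∈ᴳ H̄ × y ∈ᴳ K
          found≉    : AllPairs (λ y z → ¬ y ≈ z) found
          ∣found∣≡2^k : length found ≡ 2 ^ k

        size-bound : length (list D) ℕ.* card ≤ order
        size-bound = cosets-bound H-isSubgroup distinct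

        count-bound : 2 ^ k ≤ card
        count-bound = ≡.subst (_≤ card) ∣found∣≡2^k (distinct⇒length≤ H̄ found≉ (proj₁ ∘ found⊆))

      module _ {D : Spread K} {k x : ℕ} {T : Answers} {L : Subset order} (inv : Invariant D k x T L)
               (x≤m : x ≤ length (list D)) (g : Carrier) where

        open Invariant inv

        private
          x′ = prefix D k x
          S  = splitting D k x
          module S = Splitting S
          T′ = answers (take x′ (list D))
          shiftedS = map (λ s → g ∙ s ⁻¹) S.cofactor
          U  = answers shiftedS

        match⇒ : (m : Match U T′) → difference m ∈ᴳ H̄ × difference m K.∼ g
        match⇒ m =
          let (ans-u , s , s∈K , u≈) , _ = All.lookupAny allU m
              (ans-t , t∈K) , _ = All.lookupAny allT (Any.lookup-result m)
              eq = Any.lookup-result (Any.lookup-result m)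
          in answer≡⇒∼ (≡.trans (≡.sym ans-u) (≡.trans eq ans-t)) ,
             K.∼-trans (K.∙-cong-∼ (K.≈⇒∼ u≈) (K.⁻¹-cong-∼ (K.∈⇒∼ε t∈K)))
               (K.∼-trans (K.∙-congʳ-∼ (K.∙-congˡ-∼ (K.⁻¹-cong-∼ (K.∈⇒∼ε s∈K))))
                 (K.≈⇒∼ (trans (∙-congʳ (trans (∙-congˡ ε⁻¹≈ε) (identityʳ g))) (trans (∙-congˡ ε⁻¹≈ε) (identityʳ g)))))
          where
          allU : All (λ u → proj₂ u ≡ answer (proj₁ u) × ∃ λ s → s ∈ᴳ K × proj₁ u ≈ g ∙ s ⁻¹) U
          allU = All.map⁺ (All.map⁺ (All.tabulateₛ setoid λ {s} s∈ → ≡.refl , s , S.cofactor⊆ s∈ , refl))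
          allT : All (λ t → proj₂ t ≡ answer (proj₁ t) × proj₁ t ∈ᴳ K) T′
          allT = All.map⁺ (All.tabulateₛ setoid λ t∈ → ≡.refl , list⊆ D (∈-take⁻ x′ t∈))

        -- As g ∙ h ⁻¹ lies in K, it is congruent modulo H to some d = s ∙ t. Since h is in H, g is
        -- congruent to s ∙ t too, and cancelling s gives the collision.
        ⇒match : ∀ {h} → h ∈ᴳ H̄ → h K.∼ g → Match U T′
        ⇒match {h} h∈H h∼g =
          let d , d∈D , g∙h⁻¹∼d = covers (K.∼-sym h∼g)
              s , t , s∈S , t∈T , d≈s∙t = S.covers d∈D
              g∼s∙t : g ∼ s ∙ t
              g∼s∙t = ∼-trans (≈⇒∼ (sym (trans (∙-congˡ ε⁻¹≈ε) (identityʳ g))))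
                        (∼-trans (∙-congˡ-∼ (⁻¹-cong-∼ (∼-sym (∈⇒∼ε h∈H)))) (∼-trans g∙h⁻¹∼d (≈⇒∼ d≈s∙t)))
          in Any.map⁺ (Any.map⁺ (Any.map (λ {s′} s≈s′ → Any.map⁺ (Any.map (λ {t′} t≈t′ → ∼⇒answer≡
               (∼-trans (∙-cong-∼ g∼s∙t (≈⇒∼ (⁻¹-cong (sym s≈s′)))) (≈⇒∼ (trans (xyx⁻¹≈y s t) t≈t′)))) t∈T)) s∈S))

        table-extension : T ++ answers (drop x (take x′ (list D))) ≡ T′
        table-extension = begin
          T ++ answers (drop x (take x′ (list D)))                         ≡⟨ ≡.cong (_++ answers (drop x (take x′ (list D)))) (≡.trans table (≡.cong answers prefix-take)) ⟩
          answers (take x (take x′ (list D))) ++ answers (drop x (take x′ (list D))) ≡⟨ map-++ _ (take x (take x′ (list D))) _ ⟨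
          answers (take x (take x′ (list D)) ++ drop x (take x′ (list D))) ≡⟨ ≡.cong answers (take++drop≡id x (take x′ (list D))) ⟩
          T′                                                               ∎
          where
          open ≡.≡-Reasoning
          prefix-take : take x (list D) ≡ take x (take x′ (list D))
          prefix-take = ≡.sym (≡.trans (take-take x x′ (list D))
            (≡.cong (λ n → take n (list D)) (ℕ.m≤n⇒m⊓n≡m (prefixLength≥ {length (list D)} {k} x≤m))))

        module _ {R : Set} (hit : Answers → Carrier → QueryAlgorithm Carrier R) (miss : Answers → QueryAlgorithm Carrier R) where

          -- The old and new table sizes stand on opposite sides, which avoids the truncated
          -- difference `x′ ∸ x` and makes table size plus remaining queries the quantity handed on.
          record ContinuesAs (B : QueryAlgorithm Carrier R) : Set where
            constructor _,_
            field
              result≡  : result X f (testCoset D k x g T hit miss) ≡ result X f B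
              queries≡ : x ℕ.+ queries X f (testCoset D k x g T hit miss) ≡ x′ ℕ.+ (length S.cofactor ℕ.+ queries X f B)

            queries-transfer : ∀ c d → d ≡ length S.cofactor ℕ.+ c →
              x′ ℕ.+ queries X f B ℕ.+ d ≡ x ℕ.+ queries X f (testCoset D k x g T hit miss) ℕ.+ c
            queries-transfer c d = ledger-transfer {x} {x′} {length S.cofactor} {n′ = queries X f B} {c} {d} queries≡

          testCoset-continues : ContinuesAs (decideMatch hit miss (match? U T′))
          testCoset-continues = result≡ , queries≡
            where
            rest : Answers → QueryAlgorithm Carrier R
            rest T⁺ = probe shiftedS λ U → decideMatch hit miss (match? U (T ++ T⁺))
            T⁺ = answers (drop x (take x′ (list D)))
            subst-T′ : ∀ {A : Set} (φ : QueryAlgorithm Carrier R → A) →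
              φ (decideMatch hit miss (match? U (T ++ T⁺))) ≡ φ (decideMatch hit miss (match? U T′))
            subst-T′ φ = ≡.cong (λ T″ → φ (decideMatch hit miss (match? U T″))) table-extension
            result≡ = ≡.trans (result-probe (drop x (take x′ (list D))) rest)
                     (≡.trans (result-probe shiftedS _) (subst-T′ (result X f)))
            open ≡.≡-Reasoning
            A = testCoset D k x g T hit miss
            B = decideMatch hit miss (match? U T′)
            queries≡ : x ℕ.+ queries X f A ≡ x′ ℕ.+ (length S.cofactor ℕ.+ queries X f B)
            queries≡ = begin
              x ℕ.+ queries X f A
                ≡⟨ ≡.cong (x ℕ.+_) (queries-probe (drop x (take x′ (list D))) rest) ⟩
              x ℕ.+ (length (drop x (take x′ (list D))) ℕ.+ queries X f (rest T⁺))
                ≡⟨ ℕ.+-assoc x _ _ ⟨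
              x ℕ.+ length (drop x (take x′ (list D))) ℕ.+ queries X f (rest T⁺)
                ≡⟨ ≡.cong₂ ℕ._+_ prefix-length (queries-probe shiftedS _) ⟩
              x′ ℕ.+ (length shiftedS ℕ.+ queries X f (decideMatch hit miss (match? U (T ++ T⁺))))
                ≡⟨ ≡.cong₂ (λ m n → x′ ℕ.+ (m ℕ.+ n)) (length-map _ S.cofactor) (subst-T′ (queries X f)) ⟩
              x′ ℕ.+ (length S.cofactor ℕ.+ queries X f B) ∎
              where
              prefix-length : x ℕ.+ length (drop x (take x′ (list D))) ≡ x′
              prefix-length = begin
                x ℕ.+ length (drop x (take x′ (list D)))   ≡⟨ ≡.cong (x ℕ.+_) (length-drop x _) ⟩
                x ℕ.+ (length (take x′ (list D)) ℕ.∸ x)    ≡⟨ ≡.cong (λ n → x ℕ.+ (n ℕ.∸ x)) (≡.trans (length-take x′ (list D)) (ℕ.m≤n⇒m⊓n≡m (prefixLength≤ {length (list D)} {k} {x}))) ⟩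
                x ℕ.+ (x′ ℕ.∸ x)                           ≡⟨ ℕ.m+[n∸m]≡n (prefixLength≥ {length (list D)} {k} x≤m) ⟩
                x′                                         ∎

          data Outcome : Set where
            hits   : ∀ {h} → h ∈ᴳ H̄ → h K.∼ g → ContinuesAs (hit T′ h) → Outcome
            misses : (∀ {h} → h ∈ᴳ H̄ → ¬ h K.∼ g) → ContinuesAs (miss T′) → Outcome

          outcome : (m? : Dec (Match U T′)) → ContinuesAs (decideMatch hit miss m?) → Outcome
          outcome (yes m) = hits (proj₁ (match⇒ m)) (proj₂ (match⇒ m))
          outcome (no ¬m) = misses λ h∈H h∼g → ¬m (⇒match h∈H h∼g)

          testCoset-outcome : Outcome
          testCoset-outcome = outcome (match? U T′) testCoset-continues

    module _ {K : Subset order} (K-isSubgroup : IsSubgroup K) {g : Carrier} {p : ℕ}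
             (p-prime : Prime p) (g∉K : ¬ g ∈ᴳ K) (p·g∈K : (p · g) ∈ᴳ K)
             {D : Spread K} {k x : ℕ} {T : Answers} {L : Subset order}
             (inv : Invariant K-isSubgroup D k x T L) where

      open Step K-isSubgroup p-prime p·g∈K
      open Invariant inv

      private
        module K = Modulo K-isSubgroup
        K′-isSubgroup : IsSubgroup K′
        K′-isSubgroup = adjoin-isSubgroup K-isSubgroup p·g∈K

      -- By `coset-multiple`, H then avoids every coset a · g ∙ K with 0 < a < p. So H ∩ K does not
      -- grow, and elements of different shifts of D stay inequivalent modulo H.
      miss-invariant : (∀ {h} → h ∈ᴳ H̄ → ¬ h K.∼ g) → x ≤ length (list D) →
                       Invariant K′-isSubgroup (spread-miss D) k x T L
      miss-invariant none x≤m = record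
        { table    = ≡.trans table (≡.cong answers (≡.sym (take-shifts p x≤m)))
        ; known⁺   = λ y∈H y∈K′ → known⁺ y∈H (H∩K′⊆K y∈H (∈-adjoin⁻ K g p y∈K′))
        ; known⁻   = λ y∈L → let y∈H , y∈K = known⁻ y∈L in y∈H , K⊆K′ y∈K
        ; covers   = λ {y} y∈K′ →
            let a , a<p , y∼a·g = ∈-adjoin⁻ K g p y∈K′
                d , d∈D , y∙a·g⁻¹∼d = covers y∼a·g
            in a · g ∙ d , ∈-shifts⁺ a a<p d∈D refl ,
               ∼-trans (≈⇒∼ (sym (trans (sym (assoc _ _ _)) (xyx⁻¹≈y (a · g) y)))) (∙-congˡ-∼ y∙a·g⁻¹∼d)
        ; distinct = shifts-AllPairs (λ y≈z x≁z x∼y → x≁z (∼-trans x∼y (≈⇒∼ y≈z)))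
                       (_∘ ∙-cancelˡ-∼ g _ _) distinct p differentShifts
        ; found    = found
        ; found⊆   = λ y∈ → let y∈H , y∈K = found⊆ y∈ in y∈H , K⊆K′ y∈K
        ; found≉   = found≉
        ; ∣found∣≡2^k = ∣found∣≡2^k
        }
        where
        H∩K′⊆K : ∀ {y} → y ∈ᴳ H̄ → (∃ λ a → a < p × y K.∼ a · g) → y ∈ᴳ K
        H∩K′⊆K y∈H (zero  , a<p , y∼ε)   = K.∼ε⇒∈ y∼ε
        H∩K′⊆K y∈H (suc a , a<p , y∼a·g) =
          let h , h∈H , h∼g = coset-multiple K-isSubgroup p-prime p·g∈K z<s a<p y∼a·g H-isSubgroup y∈H
          in contradiction h∼g (none h∈H)
        differentShifts : ∀ {a y z} → 0 < a → a < p → y ∈ˡ list D → z ∈ˡ list D → ¬ y ∼ a · g ∙ z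
        differentShifts {a} 0<a a<p y∈D z∈D y∼a·g∙z =
          let h , h∈H , h∼g = coset-multiple K-isSubgroup p-prime p·g∈K 0<a a<p
                (K.∼-trans (K.∙-cong-∼ (K.∙-congˡ-∼ (K.∈⇒∼ε (list⊆ D z∈D))) (K.⁻¹-cong-∼ (K.∈⇒∼ε (list⊆ D y∈D))))
                  (K.≈⇒∼ (trans (∙-cong (identityʳ (a · g)) ε⁻¹≈ε) (identityʳ (a · g)))))
                H-isSubgroup (∼-sym y∼a·g∙z)
          in none h∈H h∼g

      -- Modulo K, `h` equals `g`, so digits with respect to `g` are digits with respect to `h`.
      -- Subtracting a · h returns to K without changing the coset of H or membership in H: D still
      -- covers, and H ∩ K′ arises from H ∩ K by adjoining `h`.
      hit-invariant : ∀ {h} → h ∈ᴳ H̄ → h K.∼ g →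
                      Invariant K′-isSubgroup (spread-hit D) (suc k) x T (adjoin L h p)
      hit-invariant {h} h∈H h∼g = record
        { table    = table
        ; known⁺   = λ y∈H y∈K′ → let a , a<p , y∼a·g = ∈-adjoin⁻ K g p y∈K′ in
            ∈-adjoin⁺ L h p a a<p (known⁺ (∙-closed y∈H (⁻¹-closed (·-∈ a h∈H)))
                                          (K.∼-trans y∼a·g (K.∼-sym (K.·-congʳ-∼ a h∼g))))
        ; known⁻   = λ y∈L′ → let a , a<p , y∙a·h⁻¹∈L = ∈-adjoin⁻ L h p y∈L′
                                  y∼a·h , yK∼a·h = known⁻ y∙a·h⁻¹∈L in
            ∈-resp-∼ y∼a·h (·-∈ a h∈H) ,
            ∼·g⇒∈-adjoin K-isSubgroup p·g∈K a (K.∼-trans yK∼a·h (K.·-congʳ-∼ a h∼g))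
        ; covers   = λ {y} y∈K′ →
            let a , a<p , y∼a·g = ∈-adjoin⁻ K g p y∈K′
                d , d∈D , y∙a·h⁻¹∼d = covers (K.∼-trans y∼a·g (K.∼-sym (K.·-congʳ-∼ a h∼g)))
            in d , d∈D , ∼-trans
                 (∼-sym (∼-trans (∙-congˡ-∼ (⁻¹-cong-∼ (·ε∼ε a (∈⇒∼ε h∈H)))) (≈⇒∼ (trans (∙-congˡ ε⁻¹≈ε) (identityʳ y)))))
                 y∙a·h⁻¹∼d
        ; distinct = distinct
        -- Since `h` is congruent to `g` and thus outside K, translation by `h` moves `found` off
        -- itself: the list doubles whatever `p` is.
        ; found    = shifts h 2 found
        ; found⊆   = λ y∈ → shifts⊆ H-isSubgroup h∈H 2 (proj₁ ∘ found⊆) y∈ ,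
                            shifts⊆ K′-isSubgroup h∈K′ 2 (K⊆K′ ∘ proj₂ ∘ found⊆) y∈
        ; found≉   = shifts-AllPairs (λ y≈z x≉z x≈y → x≉z (trans x≈y y≈z)) (_∘ ∙-cancelˡ h _ _) found≉ 2 newElements
        ; ∣found∣≡2^k = ≡.trans (length-shifts h 2 found) (≡.cong (2 ℕ.*_) ∣found∣≡2^k)
        }
        where
        newElements : ∀ {a y z} → 0 < a → a < 2 → y ∈ˡ found → z ∈ˡ found → ¬ y ≈ a · h ∙ z
        newElements {suc zero} _ _ y∈ z∈ y≈h∙z = g∉K (K.∈-resp-∼
          (K.∼-trans (K.∼-sym h∼g) (K.∼-trans (K.≈⇒∼ (sym (trans (identityʳ (h ∙ ε)) (identityʳ h))))
            (K.∼-trans (K.∙-congˡ-∼ (K.∼-sym (K.∈⇒∼ε (proj₂ (found⊆ z∈))))) (K.≈⇒∼ (sym y≈h∙z)))))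
          (proj₂ (found⊆ y∈)))
        newElements {suc (suc _)} _ (s≤s (s≤s ()))
        h∈K′ : h ∈ᴳ K′
        h∈K′ = ∼·g⇒∈-adjoin K-isSubgroup p·g∈K 1 (K.∼-trans h∼g (K.≈⇒∼ (sym (identityʳ g))))

    module _ {K : Subset order} {K-isSubgroup : IsSubgroup K} {D : Spread K} {k x : ℕ} {T : Answers} {L : Subset order}
             (inv : Invariant K-isSubgroup D k x T L) {a b : ℕ} (ledger : Ledger (length (list D)) k x a b) where

      cofactor-cost : let s = length (Splitting.cofactor (splitting D k x)) in
                      s ≤ 4 ⊎ s ℕ.* s ℕ.* suc k ≤ 16 ℕ.* length (list D)
      cofactor-cost = cofactor-bound {x = x} (nonEmpty D) (Splitting.small (splitting D k x))

      table-prefix : Invariant K-isSubgroup D k (prefix D k x) (answers (take (prefix D k x) (list D))) L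
      table-prefix = record
        { table = ≡.refl ; known⁺ = known⁺ ; known⁻ = known⁻ ; covers = covers ; distinct = distinct
        ; found = found ; found⊆ = found⊆ ; found≉ = found≉ ; ∣found∣≡2^k = ∣found∣≡2^k }
        where open Invariant inv

      ledger-spread-miss : ∀ {g p} (p-prime : Prime p) (p·g∈K : (p · g) ∈ᴳ K) →
        Ledger (length (list (Step.spread-miss K-isSubgroup p-prime p·g∈K D))) k (prefix D k x)
               (a ℕ.+ length (Splitting.cofactor (splitting D k x))) b
      ledger-spread-miss {g} {p} p-prime p·g∈K = ≡.subst (λ m → Ledger m _ _ _ _) (≡.sym (length-shifts g p (list D)))
        (ledger-miss (ledger-prefix ledger (nonEmpty D)) (nonEmpty D) (cofactor²≤16m {k = k} (nonEmpty D) cofactor-cost)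
          (ℕ.nonTrivial⇒n>1 p {{prime⇒nonTrivial p-prime}}))

    record IdentificationCost (N : ℕ) : Set where
      field
        main discoveries : ℕ
        2^k≤∣H∣ : 2 ^ discoveries ≤ card
        main²≤  : main ℕ.* main ℕ.* card ≤ 26 ℕ.* 26 ℕ.* (order ℕ.* (1 ⊔ discoveries))
        N≤      : N ≤ main ℕ.+ 4 ℕ.* discoveries

      identification-cost : N ≤ʳ fromℕ 26 *ʳ (√ ((order ÷ card) *ʳ (fromℕ 1 ⊔ʳ log₂ card)) +ʳ log₂ card)
      identification-cost = ≤ʳ-trans N (main ℕ.+ 4 ℕ.* discoveries)
        (fromℕ 26 *ʳ (√ ((order ÷ card) *ʳ (fromℕ 1 ⊔ʳ log₂ card)) +ʳ log₂ card))
        N≤ (identification-bound main discoveries order card 2^k≤∣H∣ main²≤)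

    record DecisionCost (N : ℕ) : Set where
      field
        N²≤ : N ℕ.* N ℕ.* card ≤ 26 ℕ.* 26 ℕ.* order

      decision-cost : N ≤ʳ fromℕ 26 *ʳ √ (order ÷ card)
      decision-cost = decision-bound N order card N²≤

    -- The cost is what has been spent, x + (a + b), plus the queries still to come. Each step
    -- preserves this sum, so it is bounded only once, at the end of the chain.
    identify-correct : ∀ {K} {K-isSubgroup : IsSubgroup K} (c : Chain K K-isSubgroup) {D k x T L a b} →
      Invariant K-isSubgroup D k x T L → Ledger (length (list D)) k x a b →
      result X f (identify c D k x T L) ≡ H̄ × IdentificationCost (x ℕ.+ queries X f (identify c D k x T L) ℕ.+ (a ℕ.+ b))
    identify-correct (whole K-whole) {D} {k} {x} {T} {L} {a} {b} inv ledger =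
      ⊆-antisym (λ {i} i∈L → ≡.subst (_∈ H̄) (index∘element i) (proj₁ (known⁻ (indexed i i∈L))))
                (λ {i} i∈H → ≡.subst (_∈ L) (index∘element i) (known⁺ (indexed i i∈H) (K-whole (element i)))) ,
      record
        { main        = x ℕ.+ a
        ; discoveries = k
        ; 2^k≤∣H∣     = count-bound
        ; main²≤      = begin
            (x ℕ.+ a) ℕ.* (x ℕ.+ a) ℕ.* card        ≤⟨ ℕ.*-monoˡ-≤ card (ledger-total ledger (nonEmpty D)) ⟩
            26 ℕ.* 26 ℕ.* (m ℕ.* (1 ⊔ k)) ℕ.* card  ≡⟨ rearrange (26 ℕ.* 26) m (1 ⊔ k) card ⟩
            26 ℕ.* 26 ℕ.* (m ℕ.* card ℕ.* (1 ⊔ k))  ≤⟨ ℕ.*-monoʳ-≤ (26 ℕ.* 26) (ℕ.*-monoˡ-≤ (1 ⊔ k) size-bound) ⟩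
            26 ℕ.* 26 ℕ.* (order ℕ.* (1 ⊔ k))       ∎
        ; N≤          = begin
            x ℕ.+ 0 ℕ.+ (a ℕ.+ b)    ≡⟨ ≡.cong (ℕ._+ (a ℕ.+ b)) (ℕ.+-identityʳ x) ⟩
            x ℕ.+ (a ℕ.+ b)          ≡⟨ ℕ.+-assoc x a b ⟨
            x ℕ.+ a ℕ.+ b            ≤⟨ ℕ.+-monoʳ-≤ (x ℕ.+ a) (Ledger.b≤ ledger) ⟩
            x ℕ.+ a ℕ.+ 4 ℕ.* k      ∎
        }
      where
      open Invariant inv
      open ℕ.≤-Reasoning
      m = length (list D)
      rearrange : ∀ c m q n → c ℕ.* (m ℕ.* q) ℕ.* n ≡ c ℕ.* (m ℕ.* n ℕ.* q)
      rearrange = solve 4 (λ c m q n → c :* (m :* q) :* n := c :* (m :* n :* q)) ≡.refl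
        where open +-*-Solver
      indexed : ∀ i {p : Subset order} → i ∈ p → element i ∈ᴳ p
      indexed i {p} = ≡.subst (_∈ p) (≡.sym (index∘element i))
    identify-correct {K-isSubgroup = K-isSubgroup} (extend g p p-prime g∉K p·g∈K c) {D} {k} {x} {T} {L} {a} {b} inv ledger
      = case testCoset-outcome K-isSubgroup inv (Ledger.x≤m ledger) g
             (λ T′ h → identify c (Step.spread-hit K-isSubgroup p-prime p·g∈K D) (suc k) (prefix D k x) T′ (adjoin L h p))
             (λ T′ → identify c (Step.spread-miss K-isSubgroup p-prime p·g∈K D) k (prefix D k x) T′ L) of λ where
        (hits {h} h∈H h∼g continues) →
            let a′ , b′ , ledger′ , a′+b′≡ = ledger-hit (ledger-prefix ledger (nonEmpty D)) (nonEmpty D) (cofactor-cost inv ledger)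
                correct , bound = identify-correct c (hit-invariant K-isSubgroup p-prime g∉K p·g∈K (table-prefix inv ledger) h∈H h∼g) ledger′
            in ≡.trans (ContinuesAs.result≡ continues) correct ,
               ≡.subst IdentificationCost (ContinuesAs.queries-transfer continues (a ℕ.+ b) (a′ ℕ.+ b′) a′+b′≡) bound
        (misses none continues) →
            let correct , bound = identify-correct c
                  (miss-invariant K-isSubgroup p-prime g∉K p·g∈K (table-prefix inv ledger) none (prefixLength≤ {length (list D)} {k} {x}))
                  (ledger-spread-miss inv ledger p-prime p·g∈K)
            in ≡.trans (ContinuesAs.result≡ continues) correct ,
               ≡.subst IdentificationCost (ContinuesAs.queries-transfer continues (a ℕ.+ b) (a ℕ.+ s ℕ.+ b) (xy∙z≈y∙xz a s b)) bound
      where s = length (Splitting.cofactor (splitting D k x))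

    module _ {K : Subset order} {K-isSubgroup : IsSubgroup K} {D : Spread K} {x y : ℕ} {T : Answers} {L : Subset order}
             (inv : Invariant K-isSubgroup D 0 x T L) where

      decision-affordable : ∀ a b s → Ledger (length (list D)) 0 y a b → s ℕ.* s ≤ 16 ℕ.* length (list D) →
                            DecisionCost (y ℕ.+ (s ℕ.+ (a ℕ.+ b)))
      decision-affordable a b s ledger s²≤16m .DecisionCost.N²≤ = begin
        N ℕ.* N ℕ.* card                              ≤⟨ ℕ.*-monoˡ-≤ card (ledger-total₀ {length (list D)} {y} {a} {b} {s} ledger s²≤16m) ⟩
        26 ℕ.* 26 ℕ.* length (list D) ℕ.* card        ≡⟨ ℕ.*-assoc (26 ℕ.* 26) (length (list D)) card ⟩
        26 ℕ.* 26 ℕ.* (length (list D) ℕ.* card)      ≤⟨ ℕ.*-monoʳ-≤ (26 ℕ.* 26) (Invariant.size-bound inv) ⟩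
        26 ℕ.* 26 ℕ.* order                           ∎
        where
        open ℕ.≤-Reasoning
        N = y ℕ.+ (s ℕ.+ (a ℕ.+ b))

    -- Until a hit occurs the record of H ∩ K stays trivial, and at the end of the chain it is H.
    decide-correct : ∀ {K} {K-isSubgroup : IsSubgroup K} (c : Chain K K-isSubgroup) {D x T a b} →
      Invariant K-isSubgroup D 0 x T ⁅ index ε ⁆ → Ledger (length (list D)) 0 x a b →
      (result X f (decideTrivial c D x T) ≡ true ⇔ Subgroup.IsTrivial H)
      × DecisionCost (x ℕ.+ queries X f (decideTrivial c D x T) ℕ.+ (a ℕ.+ b))
    decide-correct (whole K-whole) {D} {x} {a = a} {b} inv ledger =
      mk⇔ (λ _ y y∈H → index-injective (x∈⁅y⁆⇒x≡y (index ε) (known⁺ y∈H (K-whole y)))) (λ _ → ≡.refl) ,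
      ≡.subst DecisionCost (≡.cong (ℕ._+ (a ℕ.+ b)) (≡.sym (ℕ.+-identityʳ x)))
        (decision-affordable inv a b 0 ledger z≤n)
      where open Invariant inv
    decide-correct {K} {K-isSubgroup} (extend g p p-prime g∉K p·g∈K c) {D} {x} {T} {a} {b} inv ledger
      = case testCoset-outcome K-isSubgroup inv (Ledger.x≤m ledger) g (λ T′ h → output false)
             (λ T′ → decideTrivial c (Step.spread-miss K-isSubgroup p-prime p·g∈K D) (prefix D 0 x) T′) of λ where
        (hits {h} h∈H h∼g continues) →
            mk⇔ (λ result≡true → case ≡.trans (≡.sym (ContinuesAs.result≡ continues)) result≡true of λ ())
                -- A hit lies in g ∙ K, which does not contain ε because `g` is outside K; so it is
                -- a non-trivial element of H.
                (λ trivial → contradiction (K.∈-resp-∼ (K.∼-sym h∼g) (∈-resp-≈ K (sym (trivial h h∈H)) K.ε-closed)) g∉K) ,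
            ≡.subst DecisionCost (≡.trans (≡.cong (ℕ._+ (s ℕ.+ (a ℕ.+ b))) (≡.sym (ℕ.+-identityʳ (prefix D 0 x))))
                                                 (ContinuesAs.queries-transfer continues (a ℕ.+ b) (s ℕ.+ (a ℕ.+ b)) ≡.refl))
              (decision-affordable inv a b s (ledger-prefix ledger (nonEmpty D)) (cofactor²≤16m {k = 0} (nonEmpty D) (cofactor-cost inv ledger)))
        (misses none continues) →
            let correct , bound = decide-correct c
                  (miss-invariant K-isSubgroup p-prime g∉K p·g∈K (table-prefix inv ledger) none (prefixLength≤ {length (list D)} {0} {x}))
                  (ledger-spread-miss inv ledger p-prime p·g∈K)
            in ≡.subst (λ r → r ≡ true ⇔ Subgroup.IsTrivial H) (≡.sym (ContinuesAs.result≡ continues)) correct ,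
               ≡.subst DecisionCost (ContinuesAs.queries-transfer continues (a ℕ.+ b) (a ℕ.+ s ℕ.+ b) (xy∙z≈y∙xz a s b)) bound
      where
      module K = Modulo K-isSubgroup
      s = length (Splitting.cofactor (splitting D 0 x))

  -- The start at the trivial subgroup and the final statement.

  trivial : Subset order
  trivial = ⁅ index ε ⁆

  ∈-trivial⁺ : ∀ {x} → x ≈ ε → x ∈ᴳ trivial
  ∈-trivial⁺ x≈ε = ≡.subst (_∈ trivial) (index-cong (sym x≈ε)) (x∈⁅x⁆ (index ε))

  ∈-trivial⁻ : ∀ {x} → x ∈ᴳ trivial → x ≈ ε
  ∈-trivial⁻ = index-injective ∘ x∈⁅y⁆⇒x≡y (index ε)

  trivial-isSubgroup : IsSubgroup trivial
  trivial-isSubgroup = record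
    { ε-closed  = ∈-trivial⁺ refl
    ; ∙-closed  = λ x∈ y∈ → ∈-trivial⁺ (trans (∙-cong (∈-trivial⁻ x∈) (∈-trivial⁻ y∈)) (identityʳ ε))
    ; ⁻¹-closed = λ x∈ → ∈-trivial⁺ (trans (⁻¹-cong (∈-trivial⁻ x∈)) ε⁻¹≈ε)
    }

  initialChain : Chain trivial trivial-isSubgroup
  initialChain = chain trivial-isSubgroup (⊃-wellFounded trivial)

  trivialSpread : Spread trivial
  trivialSpread = initialSpread (∈-trivial⁺ refl)

  initialLedger : Ledger 1 0 0 0 0
  initialLedger = record { x≤m = z≤n ; x²≤ = z≤n ; a²≤ = z≤n ; b≤ = z≤n }

  initialInvariant : ∀ X f H hidden → Hidden.Invariant X f H hidden trivial-isSubgroup trivialSpread 0 0 [] trivial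
  initialInvariant X f H hidden = record
    { table    = ≡.refl
    ; known⁺   = λ _ y∈ → y∈
    ; known⁻   = λ y∈ → ε⇒∈H y∈ , y∈
    ; covers   = λ y∈ → ε , here refl , H.≈⇒∼ (∈-trivial⁻ y∈)
    ; distinct = [] ∷ []
    ; found    = [ ε ]
    ; found⊆   = λ { (here y≈ε) → ε⇒∈H (∈-trivial⁺ y≈ε) , ∈-trivial⁺ y≈ε }
    ; found≉   = [] ∷ []
    ; ∣found∣≡2^k = ≡.refl
    }
    where
    module H = Modulo (Subgroup.isSubgroup H)
    ε⇒∈H : ∀ {y} → y ∈ᴳ trivial → y ∈ᴳ Subgroup.subset H
    ε⇒∈H y∈ = ∈-resp-≈ _ (sym (∈-trivial⁻ y∈)) H.ε-closed

  decision : Σ[ A ∈ QueryAlgorithm Carrier Bool ]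
    ((X : FiniteSet) (f : Carrier → FiniteSet.Carrier X) (H : Subgroup) → let open Subgroup H in
     HiddenBy f → (result X f A ≡ true ⇔ IsTrivial) × queries X f A ≤ʳ fromℕ 26 *ʳ √ (order ÷ card))
  decision = decideTrivial initialChain trivialSpread 0 [] , λ X f H hidden →
    let correct , bound = Hidden.decide-correct X f H hidden initialChain (initialInvariant X f H hidden) initialLedger
    in correct , Hidden.DecisionCost.decision-cost (≡.subst (Hidden.DecisionCost X f H hidden) (ℕ.+-identityʳ _) bound)

  identification : Σ[ A ∈ QueryAlgorithm Carrier (Subset order) ]
    ((X : FiniteSet) (f : Carrier → FiniteSet.Carrier X) (H : Subgroup) → let open Subgroup H in
     HiddenBy f → result X f A ≡ subset
     × queries X f A ≤ʳ fromℕ 26 *ʳ (√ ((order ÷ card) *ʳ (fromℕ 1 ⊔ʳ log₂ card)) +ʳ log₂ card))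
  identification = identify initialChain trivialSpread 0 0 [] trivial , λ X f H hidden →
    let correct , bound = Hidden.identify-correct X f H hidden initialChain (initialInvariant X f H hidden) initialLedger
    in correct , Hidden.IdentificationCost.identification-cost (≡.subst (Hidden.IdentificationCost X f H hidden) (ℕ.+-identityʳ _) bound)

theorem2 :
  ∃[ C ] 0 < C ×
  ((G : FiniteAbelianGroup) → let open FiniteAbelianGroup G in
    (Σ[ A ∈ QueryAlgorithm Carrier Bool ]
      ((X : FiniteSet) (f : Carrier → FiniteSet.Carrier X)
       (H : Subgroup) → let open Subgroup H in
       HiddenBy f →
         (result X f A ≡ true ⇔ IsTrivial)
       × queries X f A ≤ʳ fromℕ C *ʳ √ (order ÷ card)))
    ×
    (Σ[ A ∈ QueryAlgorithm Carrier (Subset order) ]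
      ((X : FiniteSet) (f : Carrier → FiniteSet.Carrier X)
       (H : Subgroup) → let open Subgroup H in
       HiddenBy f →
         result X f A ≡ subset
       × queries X f A ≤ʳ
           fromℕ C *ʳ (√ ((order ÷ card) *ʳ (fromℕ 1 ⊔ʳ log₂ card)) +ʳ log₂ card))))
theorem2 = 26 , z<s , λ G → HiddenSubgroup.decision G , HiddenSubgroup.identification G
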